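{- There is an algorithm that, given a finite, simple, unweighted, undirected, connected graph $G$ on $n$ vertices, a set $S\subseteq V(G)$ with $|S|=k$ such that $G-S$ is a split graph, and an integer $\ell$, decides in time $\mathcal{O}(2^{\mathcal{O}(k\log k)}\, n^{\mathcal{O}(1)})$ whether there exists a shortest path $P$ in $G$ such that $d_G(v,P)\le \ell$ for every $v\in V(G)$.
   Context: A split graph is a graph whose vertex set can be partitioned into a clique and an independent set. $d_G$ denotes graph distance and $d_G(v,P)=\min_{w\in V(P)}d_G(v,w)$. A shortest path is a path whose length equals the distance in $G$ between its endpoints. -}

module Defs where

open import Data.Bool.Base using (Bool; true; false; T; not)
open import Data.Fin.Base using (Fin)
open import Data.Fin.Subset using (Subset; _∉_)
open import Data.Integer.Base as ℤ using (ℤ; +_; -[1+_])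
open import Data.List.Base as List using (List; []; _∷_)
open import Data.List.Membership.Propositional using (_∈_)
open import Data.List.Relation.Unary.Unique.Propositional using (Unique)
open import Data.Nat.Base using (ℕ; zero; suc; _+_; _≤_)
open import Data.Product.Base using (∃; ∃-syntax; _×_)
open import Data.Refinement.Base using (Refinement-syntax; value)
open import Data.Vec.Base as Vec using (Vec; []; _∷_)
open import Relation.Binary.PropositionalEquality.Core using (_≡_; _≢_)
open import Relation.Nullary.Negation.Core using (¬_)

------------------------------------------------------------------------
-- Graphs

record Graph (V : Set) : Set where
  field
    adj    : V → V → Bool
    sym    : ∀ u v → adj u v ≡ adj v u
    irrefl : ∀ v → adj v v ≡ false

  infix 4 _~_
  _~_ : V → V → Set
  u ~ v = T (adj u v)

open Graph using (adj; sym; irrefl)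

infixr 5 _∷_

-- Walks, indexed by both endpoints and the number of edges.
data Walk {V : Set} (G : Graph V) : V → V → ℕ → Set where
  [_] : ∀ u → Walk G u u 0
  _∷_ : ∀ {u v w m} → Graph._~_ G u v → Walk G v w m → Walk G u w (suc m)

module _ {V : Set} (G : Graph V) where

  open Graph G using (_~_)

  vertices : ∀ {u v m} → Walk G u v m → List V
  vertices [ u ]             = u ∷ []
  vertices (_∷_ {u = u} _ w) = u ∷ vertices w

  -- The graph without vertices is not connected.
  Connected : Set
  Connected = V × (∀ u v → ∃[ m ] Walk G u v m)

  IsClique : (V → Bool) → Set
  IsClique C = ∀ {u v} → T (C u) → T (C v) → u ≢ v → u ~ v

  IsIndependent : (V → Bool) → Set
  IsIndependent I = ∀ {u v} → T (I u) → T (I v) → ¬ (u ~ v)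

  -- C is the clique and its complement the independent set; either part
  -- may be empty.
  IsSplit : Set
  IsSplit = ∃[ C ] IsClique C × IsIndependent (λ v → not (C v))

infixl 6 _─_

_─_ : ∀ {n} → Graph (Fin n) → (S : Subset n) → Graph [ v ∈ Fin n ∣ v ∉ S ]
G ─ S = record
  { adj    = λ u v → adj G (value u) (value v)
  ; sym    = λ u v → sym G (value u) (value v)
  ; irrefl = λ v → irrefl G (value v)
  }

------------------------------------------------------------------------
-- Distances and shortest paths

IsMinimum : (ℕ → Set) → ℕ → Set
IsMinimum P d = P d × (∀ m → P m → d ≤ m)

module _ {V : Set} (G : Graph V) where

  -- d_G(u,v) = d, as a relation: d_G is a function only once G is connected.
  Distance : V → V → ℕ → Set
  Distance u v = IsMinimum (Walk G u v)

  record ShortestPath : Set where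
    field
      {source target} : V
      {len}           : ℕ
      walk            : Walk G source target len
      isPath          : Unique (vertices G walk)
      isShortest      : Distance source target len

  V⟨_⟩ : ShortestPath → List V
  V⟨ P ⟩ = vertices G (ShortestPath.walk P)

  -- d_G(v,P) = d
  DistanceToPath : V → ShortestPath → ℕ → Set
  DistanceToPath v P = IsMinimum λ d → ∃[ w ] w ∈ V⟨ P ⟩ × Distance v w d

  HasEccentricity≤ : ShortestPath → ℤ → Set
  HasEccentricity≤ P ℓ = ∀ v → ∃[ d ] DistanceToPath v P d × + d ℤ.≤ ℓ

------------------------------------------------------------------------
-- Algorithms
--
-- The model of computation is a first-order functional language with
-- general recursion whose values are immutable binary trees (Jones,
-- "Computability and Complexity", 1997).  Values can be represented by
-- pointers to shared cells, so for a fixed program each rule of the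
-- semantics takes a constant number of RAM steps; conversely, the language
-- simulates Turing machines with polynomial overhead.

infixr 5 _∙_

data Tree : Set where
  nil : Tree
  _∙_ : Tree → Tree → Tree

-- Expressions with n variables in scope (de Bruijn indices), over m global
-- functions of the given arities.  In `case e e₁ e₂`, the branch e₁ is for
-- nil, and e₂ is for x ∙ y with x bound to variable 0 and y to variable 1.
data Expr {m : ℕ} (arity : Fin m → ℕ) (n : ℕ) : Set where
  var  : Fin n → Expr arity n
  nil  : Expr arity n
  _∙_  : Expr arity n → Expr arity n → Expr arity n
  case : Expr arity n → Expr arity n → Expr arity (2 + n) → Expr arity n
  bind : Expr arity n → Expr arity (1 + n) → Expr arity n
  call : (f : Fin m) → Vec (Expr arity n) (arity f) → Expr arity n

record Program (inputs : ℕ) : Set where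
  field
    {#functions} : ℕ
    arity        : Fin #functions → ℕ
    body         : (f : Fin #functions) → Expr arity (arity f)
    main         : Expr arity inputs

module Semantics {i : ℕ} (p : Program i) where

  open Program p

  infix 4 _⊢_⇓_[_] _⊢*_⇓_[_]

  -- ρ ⊢ e ⇓ x [ t ] : in the environment ρ, e evaluates (call by value) to x
  -- in t steps; one step is charged for every evaluated subexpression.
  data _⊢_⇓_[_] {n} (ρ : Vec Tree n) : Expr arity n → Tree → ℕ → Set
  data _⊢*_⇓_[_] {n} (ρ : Vec Tree n) :
    ∀ {k} → Vec (Expr arity n) k → Vec Tree k → ℕ → Set

  data _⊢_⇓_[_] {n} ρ where
    var  : ∀ x → ρ ⊢ var x ⇓ Vec.lookup ρ x [ 1 ]
    nil  : ρ ⊢ nil ⇓ nil [ 1 ]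
    _∙_  : ∀ {e₁ e₂ x y s t} →
           ρ ⊢ e₁ ⇓ x [ s ] → ρ ⊢ e₂ ⇓ y [ t ] →
           ρ ⊢ e₁ ∙ e₂ ⇓ x ∙ y [ suc (s + t) ]
    case-nil : ∀ {e e₁ e₂ z s t} →
           ρ ⊢ e ⇓ nil [ s ] → ρ ⊢ e₁ ⇓ z [ t ] →
           ρ ⊢ case e e₁ e₂ ⇓ z [ suc (s + t) ]
    case-∙ : ∀ {e e₁ e₂ x y z s t} →
           ρ ⊢ e ⇓ x ∙ y [ s ] → (x ∷ y ∷ ρ) ⊢ e₂ ⇓ z [ t ] →
           ρ ⊢ case e e₁ e₂ ⇓ z [ suc (s + t) ]
    bind : ∀ {e₁ e₂ x z s t} →
           ρ ⊢ e₁ ⇓ x [ s ] → (x ∷ ρ) ⊢ e₂ ⇓ z [ t ] →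
           ρ ⊢ bind e₁ e₂ ⇓ z [ suc (s + t) ]
    call : ∀ {f es xs z s t} →
           ρ ⊢* es ⇓ xs [ s ] → xs ⊢ body f ⇓ z [ t ] →
           ρ ⊢ call f es ⇓ z [ suc (s + t) ]

  data _⊢*_⇓_[_] {n} ρ where
    []  : ρ ⊢* [] ⇓ [] [ 0 ]
    _∷_ : ∀ {k e x s t} {es : Vec (Expr arity n) k} {xs} →
          ρ ⊢ e ⇓ x [ s ] → ρ ⊢* es ⇓ xs [ t ] →
          ρ ⊢* e ∷ es ⇓ x ∷ xs [ s + t ]

-- On the given inputs, p halts with output y after t steps.
infix 4 _⟪_⟫⇓_[_]

_⟪_⟫⇓_[_] : ∀ {i} → Program i → Vec Tree i → Tree → ℕ → Set
p ⟪ xs ⟫⇓ y [ t ] = xs ⊢ Program.main p ⇓ y [ t ]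
  where open Semantics p

------------------------------------------------------------------------
-- Representation of inputs and outputs as trees

⌜_⌝ᵇ : Bool → Tree
⌜ false ⌝ᵇ = nil
⌜ true  ⌝ᵇ = nil ∙ nil

⌜_⌝ℕ : ℕ → Tree
⌜ zero  ⌝ℕ = nil
⌜ suc n ⌝ℕ = nil ∙ ⌜ n ⌝ℕ

-- A sign bit (true if negative) together with a unary numeral.  The choice of
-- numeral system is immaterial for running times bounded independently of the
-- integer, in which only a bounded part of the numeral can be read.
⌜_⌝ℤ : ℤ → Tree
⌜ + n      ⌝ℤ = ⌜ false ⌝ᵇ ∙ ⌜ n ⌝ℕ
⌜ -[1+ n ] ⌝ℤ = ⌜ true ⌝ᵇ ∙ ⌜ n ⌝ℕ

⌜_⌝* : List Tree → Tree
⌜_⌝* = List.foldr _∙_ nil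

⌜_⌝ˢ : ∀ {n} → Subset n → Tree
⌜ S ⌝ˢ = ⌜ List.map ⌜_⌝ᵇ (Vec.toList S) ⌝*

-- The adjacency matrix, as the list of its rows.
⌜_⌝ᴳ : ∀ {n} → Graph (Fin n) → Tree
⌜ G ⌝ᴳ = ⌜ List.tabulate (λ u → ⌜ List.tabulate (λ v → ⌜ adj G u v ⌝ᵇ) ⌝*) ⌝*

-- Let k = |S| and let P be a shortest path from u to x, so that a vertex of P is
-- determined by its distance to x.  P meets the clique C in at most 2 vertices,
-- S in at most k, and no two independent vertices are adjacent, whence all
-- distances are at most 2k + 4.  A walk from v to the nearest vertex w of P
-- either meets S, or is trivial, or shows that w lies in N[C].  The vertices of
-- N[C] are pairwise at distance at most 3, so those on P are among four
-- consecutive vertices of P.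
--
-- The algorithm therefore guesses, for each s ∈ S, the distance from s to P and
-- the position on P where it is attained, and the four vertices with their
-- positions: (2k + 5)^(2k + 8) n⁴ guesses suffice.  Vertices that are not
-- within distance ℓ of P by virtue of the guess must lie on P, at a position
-- known from their distance to x.  Given x and the guess, the vertices admitted
-- at each position are thus known independently of each other, and searching
-- for a path through them is a layered reachability problem.

module Submission where

open import Defs
open import Data.Bool.Base using (Bool; true; false; T; not; _∧_; _∨_; if_then_else_)
open import Data.Bool.ListAction using (any; all)
open import Data.Bool.Properties using (T-∧; T?)
open import Data.Empty using (⊥)
open import Data.Fin.Base using (Fin; zero; suc; toℕ)
open import Data.Fin.Properties as Fin
  using (+↔⊎; 0↔⊥; 1↔⊤; toℕ<n; toℕ-injective; injective⇒≤; nonZeroIndex)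
open import Data.Fin.Subset as Subset using (Subset; ∣_∣)
open import Data.Integer.Base as ℤ using (ℤ)
import Data.Integer.Properties as ℤ
open import Data.Irrelevant using ([_])
open import Data.List.Base as List
  using (List; []; _∷_; _++_; allFin; applyUpTo; cartesianProductWith; downFrom;
         filterᵇ; length)
open import Data.List.Membership.Propositional using (_∈_; find; lose)
open import Data.List.Membership.Propositional.Properties
  using (∈-allFin; ∈-applyUpTo⁺; ∈-cartesianProductWith⁺;
         ∈-cartesianProductWith⁻; ∈-downFrom⁺; ∈-downFrom⁻; ∈-filter⁺;
         ∈-filter⁻; ∈-lookup)
open import Data.List.Properties
  using (length-++; length-downFrom; length-filter; length-map;
         length-tabulate; map-++; map-cong; map-id; map-tabulate; map-∘)
open import Data.List.Relation.Unary.All as All using (All; []; _∷_)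
open import Data.List.Relation.Unary.All.Properties as All using (all⁺; all⁻)
open import Data.List.Relation.Unary.AllPairs using ([]; _∷_)
open import Data.List.Relation.Unary.Any as Any using (here; there)
open import Data.List.Relation.Unary.Any.Properties
  using (any⁺; any⁻; lookup-index)
open import Data.List.Relation.Unary.Unique.Propositional using (Unique)
import Data.List.Relation.Unary.Unique.Propositional.Properties as Unique
open import Data.Nat.Base
open import Data.Nat.Induction using (<-rec)
open import Data.Nat.Logarithm
open import Data.Nat.Properties
open import Data.Nat.Tactic.RingSolver using (solve-∀)
open import Data.Product.Base using (Σ-syntax; ∃-syntax; ∃₂; _×_; _,_; proj₁; proj₂)
open import Data.Refinement.Base using (_,_; value)
open import Data.Sum.Base using (_⊎_; inj₁; inj₂)
open import Data.Sum.Function.Propositional using (_⊎-↔_)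
open import Data.Unit.Base using (⊤; tt)
open import Data.Vec.Base as Vec using (Vec; []; _∷_; lookup)
open import Data.Vec.Properties using ([]=⇒lookup)
open import Function.Base using (_∘_; id)
open import Function.Bundles using (_↔_; Inverse; Equivalence)
open import Function.Properties.Inverse using (↔-trans)
open import Relation.Binary.PropositionalEquality
open import Relation.Nullary using (¬_; Dec; yes; no; contradiction)
open import Relation.Nullary.Decidable using (_×-dec_; _⊎-dec_)
open import Relation.Nullary.Reflects using (Reflects; fromEquivalence)

-- The running time is controlled by a single number `N`, the number of guesses. The only loops of
-- the algorithm are primitive recursions along lists and numerals. If all of them have depth at
-- most `N`, the compiled program halts within `8 + steps e N` steps, and this is polynomial in `N`
-- with a degree that depends on the term alone. It therefore suffices to bound by `N` every list
-- and numeral that is recursed on, and to bound `N` itself by a constant times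
-- `2 ^ (24 * (k * ⌈log₂ k ⌉)) * n ^ 4`.
--
-- Two obstacles shape the term. The numeral of `ℓ` is unbounded, so it may only stand on the side
-- of a comparison that is not recursed on. Distances must be found by a search of bounded length;
-- it is cut off at `D`, which is harmless only because all true distances are below `D`. To avoid
-- circularity, that bound is proved for a distance function `δ` whose search limits come from the
-- walks that connectedness provides, and is then transferred to the computed `dist`.

-- A total language with bounded recursion, and its compilation

-- Terms of a total language: `rec l z s` is primitive recursion along the
-- right spine of l, where s sees the head, the tail and the recursive result
-- as variables 0, 1 and 2.
data Term (m : ℕ) : Set where
  var           : Fin m → Term m
  nil           : Term m
  _∙_           : Term m → Term m → Term m
  fst snd       : Term m → Term m
  cond          : Term m → Term m → Term m → Term m
  bind          : Term m → Term (1 + m) → Term m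
  rec           : Term m → Term m → Term (3 + m) → Term m

-- In N ∣ ρ ⊢ e ↦ x, every recursion performed has depth at most N.
infix 4 _∣_⊢_↦_

data _∣_⊢_↦_ (N : ℕ) {m} (ρ : Vec Tree m) : Term m → Tree → Set

data Loop (N : ℕ) {m} (ρ : Vec Tree m) (z : Tree) (e : Term (3 + m)) :
  ℕ → Tree → Tree → Set

data _∣_⊢_↦_ N {m} ρ where
  var      : ∀ {i x} → lookup ρ i ≡ x → N ∣ ρ ⊢ var i ↦ x
  nil      : N ∣ ρ ⊢ nil ↦ nil
  _∙_      : ∀ {e₁ e₂ x y} →
             N ∣ ρ ⊢ e₁ ↦ x → N ∣ ρ ⊢ e₂ ↦ y → N ∣ ρ ⊢ e₁ ∙ e₂ ↦ x ∙ y
  fst      : ∀ {e x y} → N ∣ ρ ⊢ e ↦ x ∙ y → N ∣ ρ ⊢ fst e ↦ x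
  snd      : ∀ {e x y} → N ∣ ρ ⊢ e ↦ x ∙ y → N ∣ ρ ⊢ snd e ↦ y
  snd-nil  : ∀ {e} → N ∣ ρ ⊢ e ↦ nil → N ∣ ρ ⊢ snd e ↦ nil
  cond-∙   : ∀ {e e₁ e₂ x y z} → N ∣ ρ ⊢ e ↦ x ∙ y → N ∣ ρ ⊢ e₁ ↦ z →
             N ∣ ρ ⊢ cond e e₁ e₂ ↦ z
  cond-nil : ∀ {e e₁ e₂ z} → N ∣ ρ ⊢ e ↦ nil → N ∣ ρ ⊢ e₂ ↦ z →
             N ∣ ρ ⊢ cond e e₁ e₂ ↦ z
  bind     : ∀ {e₁ e₂ x y} → N ∣ ρ ⊢ e₁ ↦ x → N ∣ x ∷ ρ ⊢ e₂ ↦ y →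
             N ∣ ρ ⊢ bind e₁ e₂ ↦ y
  rec      : ∀ {e₁ e₂ e₃ j x y z} → N ∣ ρ ⊢ e₁ ↦ x → N ∣ ρ ⊢ e₂ ↦ y →
             Loop N ρ y e₃ j x z → j ≤ N → N ∣ ρ ⊢ rec e₁ e₂ e₃ ↦ z

data Loop N {m} ρ z e where
  nil : Loop N ρ z e 0 nil z
  _∙_ : ∀ {j x y u v} → Loop N ρ z e j y u → N ∣ x ∷ y ∷ u ∷ ρ ⊢ e ↦ v →
        Loop N ρ z e (suc j) (x ∙ y) v

-- Every recursion of a term becomes a unary function of the program.  The
-- environment is kept as a single tree in variable 0, so that it can be
-- passed to these functions.
Rec : ∀ {m} → Term m → Set
Rec (var i)        = ⊥
Rec nil            = ⊥
Rec (e₁ ∙ e₂)      = Rec e₁ ⊎ Rec e₂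
Rec (fst e)        = Rec e
Rec (snd e)        = Rec e
Rec (cond e e₁ e₂) = Rec e ⊎ (Rec e₁ ⊎ Rec e₂)
Rec (bind e₁ e₂)   = Rec e₁ ⊎ Rec e₂
Rec (rec e₁ e₂ e₃) = ⊤ ⊎ (Rec e₁ ⊎ (Rec e₂ ⊎ Rec e₃))

Finite : Set → Set
Finite A = ∃[ M ] Fin M ↔ A

⊎-finite : ∀ {A B} → Finite A → Finite B → Finite (A ⊎ B)
⊎-finite (_ , A↔) (_ , B↔) = _ , ↔-trans +↔⊎ (A↔ ⊎-↔ B↔)

Rec-finite : ∀ {m} (e : Term m) → Finite (Rec e)
Rec-finite (var i)        = 0 , 0↔⊥
Rec-finite nil            = 0 , 0↔⊥
Rec-finite (e₁ ∙ e₂)      = ⊎-finite (Rec-finite e₁) (Rec-finite e₂)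
Rec-finite (fst e)        = Rec-finite e
Rec-finite (snd e)        = Rec-finite e
Rec-finite (cond e e₁ e₂) =
  ⊎-finite (Rec-finite e) (⊎-finite (Rec-finite e₁) (Rec-finite e₂))
Rec-finite (bind e₁ e₂)   = ⊎-finite (Rec-finite e₁) (Rec-finite e₂)
Rec-finite (rec e₁ e₂ e₃) =
  ⊎-finite (1 , 1↔⊤)
    (⊎-finite (Rec-finite e₁) (⊎-finite (Rec-finite e₂) (Rec-finite e₃)))

Code : ℕ → ℕ → Set
Code M m = Expr {M} (λ _ → 1) m

pattern 0F = zero
pattern 1F = suc zero
pattern 2F = suc (suc zero)
pattern 3F = suc (suc (suc zero))

project : ∀ {M m k} → Fin m → Code M (suc k)
project zero    = case (var 0F) nil (var 0F)
project (suc i) = case (var 0F) nil (bind (var 1F) (project i))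

code : ∀ {M m k} (e : Term m) → (Rec e → Fin M) → Code M (suc k)
code (var i) ι        = project i
code nil ι            = nil
code (e₁ ∙ e₂) ι      = code e₁ (ι ∘ inj₁) ∙ code e₂ (ι ∘ inj₂)
code (fst e) ι        = case (code e ι) nil (var 0F)
code (snd e) ι        = case (code e ι) nil (var 1F)
code (cond e e₁ e₂) ι =
  case (code e (ι ∘ inj₁)) (code e₂ (ι ∘ inj₂ ∘ inj₂))
    -- This branch of `case` has two new variables in front, so the environment is bound again as
    -- variable 0.
    (bind (var 2F) (code e₁ (ι ∘ inj₂ ∘ inj₁)))
code (bind e₁ e₂) ι   =
  bind (code e₁ (ι ∘ inj₁) ∙ var 0F) (code e₂ (ι ∘ inj₂))
code (rec e₁ e₂ e₃) ι =
  call (ι (inj₁ tt))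
    ((code e₁ (ι ∘ inj₂ ∘ inj₁) ∙
      (code e₂ (ι ∘ inj₂ ∘ inj₂ ∘ inj₁) ∙ var 0F)) ∷ [])

-- The argument is `x ∙ (z ∙ ρ)`: the list, the base value and the packed environment, the last two
-- passed on unchanged. Inside the three `case`s, variables 0 to 3 are head, tail, base value and
-- environment.
loop : ∀ {M} → Fin M → (∀ {k} → Code M (suc k)) → Code M 1
loop f s =
  case (var 0F) nil
    (case (var 1F) nil
      (case (var 2F) (var 0F)
        (bind (var 0F ∙ (var 1F ∙
                (call f ((var 1F ∙ (var 2F ∙ var 3F)) ∷ []) ∙ var 3F)))
          s)))

functions : ∀ {M m} (e : Term m) → (Rec e → Fin M) → Rec e → Code M 1
functions (e₁ ∙ e₂) ι (inj₁ r)                    =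
  functions e₁ (ι ∘ inj₁) r
functions (e₁ ∙ e₂) ι (inj₂ r)                    =
  functions e₂ (ι ∘ inj₂) r
functions (fst e) ι r                             = functions e ι r
functions (snd e) ι r                             = functions e ι r
functions (cond e e₁ e₂) ι (inj₁ r)               =
  functions e (ι ∘ inj₁) r
functions (cond e e₁ e₂) ι (inj₂ (inj₁ r))        =
  functions e₁ (ι ∘ inj₂ ∘ inj₁) r
functions (cond e e₁ e₂) ι (inj₂ (inj₂ r))        =
  functions e₂ (ι ∘ inj₂ ∘ inj₂) r
functions (bind e₁ e₂) ι (inj₁ r)                 =
  functions e₁ (ι ∘ inj₁) r
functions (bind e₁ e₂) ι (inj₂ r)                 =
  functions e₂ (ι ∘ inj₂) r
functions (rec e₁ e₂ e₃) ι (inj₁ tt)              =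
  loop (ι (inj₁ tt)) (code e₃ (ι ∘ inj₂ ∘ inj₂ ∘ inj₂))
functions (rec e₁ e₂ e₃) ι (inj₂ (inj₁ r))        =
  functions e₁ (ι ∘ inj₂ ∘ inj₁) r
functions (rec e₁ e₂ e₃) ι (inj₂ (inj₂ (inj₁ r))) =
  functions e₂ (ι ∘ inj₂ ∘ inj₂ ∘ inj₁) r
functions (rec e₁ e₂ e₃) ι (inj₂ (inj₂ (inj₂ r))) =
  functions e₃ (ι ∘ inj₂ ∘ inj₂ ∘ inj₂) r

pack : ∀ {m} → Vec Tree m → Tree
pack []      = nil
pack (x ∷ ρ) = x ∙ pack ρ

-- An upper bound only, whence both branches of `cond` are added up. Nested recursions multiply, so
-- the degree in `N` is at most the nesting depth of `rec`.
steps : ∀ {m} → Term m → ℕ → ℕ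
steps (var i) N        = 3 + 4 * toℕ i
steps nil N            = 1
steps (e₁ ∙ e₂) N      = 1 + (steps e₁ N + steps e₂ N)
steps (fst e) N        = 2 + steps e N
steps (snd e) N        = 2 + steps e N
steps (cond e e₁ e₂) N = 3 + (steps e N + (steps e₁ N + steps e₂ N))
steps (bind e₁ e₂) N   = 3 + (steps e₁ N + steps e₂ N)
steps (rec e₁ e₂ e₃) N =
  11 + (steps e₁ N + (steps e₂ N + N * (19 + steps e₃ N)))

module Simulation {M i : ℕ} (body : Fin M → Code M 1) (main : Code M i) where

  program : Program i
  program = record
    { #functions = M ; arity = λ _ → 1 ; body = body ; main = main }

  open Semantics program

  -- The labelling `ι` is arbitrary so that the property restricts to subterms, whose recursions are
  -- only some of the functions of the program.
  Implements : ∀ {m} (e : Term m) → (Rec e → Fin M) → Set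
  Implements e ι = ∀ r → body (ι r) ≡ functions e ι r

  project-⇓ : ∀ {m k} (ρ : Vec Tree m) {σ : Vec Tree k} i →
              (pack ρ ∷ σ) ⊢ project i ⇓ lookup ρ i [ 3 + 4 * toℕ i ]
  project-⇓ (x ∷ ρ) zero        = case-∙ (var 0F) (var 0F)
  project-⇓ (x ∷ ρ) {σ} (suc i) =
    subst (λ t → (pack (x ∷ ρ) ∷ σ) ⊢ project (suc i) ⇓ lookup ρ i [ t ])
      (4+[3+4i] (toℕ i))
      (case-∙ (var 0F) (bind (var 1F) (project-⇓ ρ i)))
    where
    4+[3+4i] : ∀ i → 4 + (3 + 4 * i) ≡ 3 + 4 * suc i
    4+[3+4i] = solve-∀

  infix 4 _⊢_⇓_[≤_]
  _⊢_⇓_[≤_] : ∀ {m} → Vec Tree m → Code M m → Tree → ℕ → Set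
  ρ ⊢ e ⇓ x [≤ b ] = ∃[ t ] ρ ⊢ e ⇓ x [ t ] × t ≤ b

  simulate : ∀ {N m k} {ρ : Vec Tree m} {σ : Vec Tree k} {e x}
             (ι : Rec e → Fin M) →
             Implements e ι → N ∣ ρ ⊢ e ↦ x →
             (pack ρ ∷ σ) ⊢ code e ι ⇓ x [≤ steps e N ]

  simulate-loop : ∀ {N m} {ρ : Vec Tree m} {z e₁ e₂ e₃ j x y}
                  (ι : Rec (rec e₁ e₂ e₃) → Fin M) →
                  Implements (rec e₁ e₂ e₃) ι → Loop N ρ z e₃ j x y →
                  ((x ∙ (z ∙ pack ρ)) ∷ []) ⊢ body (ι (inj₁ tt)) ⇓ y
                    [≤ 7 + j * (19 + steps e₃ N) ]

  simulate {ρ = ρ} ι f (var {i} refl) = _ , project-⇓ ρ i , ≤-refl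
  simulate ι f nil = _ , nil , ≤-refl
  simulate ι f (d₁ ∙ d₂) =
    let _ , r₁ , b₁ = simulate (ι ∘ inj₁) (f ∘ inj₁) d₁
        _ , r₂ , b₂ = simulate (ι ∘ inj₂) (f ∘ inj₂) d₂
    in _ , r₁ ∙ r₂ , s≤s (+-mono-≤ b₁ b₂)
  simulate ι f (fst d) =
    let _ , r , b = simulate ι f d
    in _ , case-∙ r (var 0F) , s≤s (≤-trans (≤-reflexive (+-comm _ 1)) (s≤s b))
  simulate ι f (snd d) =
    let _ , r , b = simulate ι f d
    in _ , case-∙ r (var 1F) , s≤s (≤-trans (≤-reflexive (+-comm _ 1)) (s≤s b))
  simulate ι f (snd-nil d) =
    let _ , r , b = simulate ι f d
    in _ , case-nil r nil , s≤s (≤-trans (≤-reflexive (+-comm _ 1)) (s≤s b))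
  simulate ι f (cond-∙ d d₁) =
    let s , r , b = simulate (ι ∘ inj₁) (f ∘ inj₁) d
        t , r₁ , b₁ = simulate (ι ∘ inj₂ ∘ inj₁) (f ∘ inj₂ ∘ inj₁) d₁
    in _ , case-∙ r (bind (var 2F) r₁)
     , ≤-trans (≤-reflexive (reorder s t))
         (+-monoʳ-≤ 3 (+-mono-≤ b (≤-trans b₁ (m≤m+n _ _))))
    where
    reorder : ∀ s t → suc (s + suc (1 + t)) ≡ 3 + (s + t)
    reorder = solve-∀
  simulate ι f (cond-nil d d₂) =
    let _ , r , b = simulate (ι ∘ inj₁) (f ∘ inj₁) d
        _ , r₂ , b₂ = simulate (ι ∘ inj₂ ∘ inj₂) (f ∘ inj₂ ∘ inj₂) d₂
    in _ , case-nil r r₂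
     , ≤-trans (s≤s (+-mono-≤ b (≤-trans b₂ (m≤n+m _ _)))) (m≤n+m _ 2)
  simulate ι f (bind d₁ d₂) =
    let s , r₁ , b₁ = simulate (ι ∘ inj₁) (f ∘ inj₁) d₁
        t , r₂ , b₂ = simulate (ι ∘ inj₂) (f ∘ inj₂) d₂
    in _ , bind (r₁ ∙ var 0F) r₂
     , ≤-trans (≤-reflexive (reorder s t)) (+-monoʳ-≤ 3 (+-mono-≤ b₁ b₂))
    where
    reorder : ∀ s t → suc (suc (s + 1) + t) ≡ 3 + (s + t)
    reorder = solve-∀
  simulate {N} ι f (rec {e₁} {e₂} {e₃} {j} d₁ d₂ l j≤N) =
    let s , r₁ , b₁ = simulate (ι ∘ inj₂ ∘ inj₁) (f ∘ inj₂ ∘ inj₁) d₁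
        t , r₂ , b₂ = simulate (ι ∘ inj₂ ∘ inj₂ ∘ inj₁) (f ∘ inj₂ ∘ inj₂ ∘ inj₁) d₂
        u , r₃ , b₃ = simulate-loop {e₁ = e₁} {e₂} ι f l
    in _ , call ((r₁ ∙ (r₂ ∙ var 0F)) ∷ []) r₃ , (begin
      suc (suc (s + suc (t + 1)) + 0 + u)
        ≡⟨ reorder s t u ⟩
      4 + (s + (t + u))
        ≤⟨ +-monoʳ-≤ 4 (+-mono-≤ b₁ (+-mono-≤ b₂ b₃)) ⟩
      4 + (steps e₁ N + (steps e₂ N + (7 + j * (19 + steps e₃ N))))
        ≡⟨ reorder′ (steps e₁ N) (steps e₂ N) _ ⟩
      11 + (steps e₁ N + (steps e₂ N + j * (19 + steps e₃ N)))
        ≤⟨ +-monoʳ-≤ 11 (+-monoʳ-≤ (steps e₁ N) (+-monoʳ-≤ (steps e₂ N)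
             (*-monoˡ-≤ _ j≤N))) ⟩
      steps (rec e₁ e₂ e₃) N ∎)
    where
    open ≤-Reasoning
    reorder : ∀ s t u → suc (suc (s + suc (t + 1)) + 0 + u) ≡ 4 + (s + (t + u))
    reorder = solve-∀
    reorder′ : ∀ s t u → 4 + (s + (t + (7 + u))) ≡ 11 + (s + (t + u))
    reorder′ = solve-∀

  simulate-loop ι f nil rewrite f (inj₁ tt) =
    _ , case-∙ (var 0F) (case-∙ (var 1F) (case-nil (var 2F) (var 0F))) , ≤-refl
  simulate-loop {N} {e₁ = e₁} {e₂} {e₃} {suc j} ι f (l ∙ d) =
    let t , r₁ , b₁ = simulate-loop {e₁ = e₁} {e₂} ι f l
        u , r₂ , b₂ = simulate (ι ∘ inj₂ ∘ inj₂ ∘ inj₂) (f ∘ inj₂ ∘ inj₂ ∘ inj₂) d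
    in _ , subst (λ e → _ ⊢ e ⇓ _ [ 7 + (5 + (6 + t + 1) + u) ]) (sym (f (inj₁ tt)))
             (case-∙ (var 0F) (case-∙ (var 1F) (case-∙ (var 2F)
               (bind (var 0F ∙ (var 1F ∙
                       (call ((var 1F ∙ (var 2F ∙ var 3F)) ∷ []) r₁ ∙ var 3F)))
                 r₂))))
     , (begin
      _ ≡⟨ reorder t u ⟩
      19 + (u + t) ≤⟨ +-monoʳ-≤ 19 (+-mono-≤ b₂ b₁) ⟩
      19 + (steps e₃ N + (7 + j * (19 + steps e₃ N)))
        ≡⟨ reorder′ (steps e₃ N) _ ⟩
      7 + suc j * (19 + steps e₃ N) ∎)
    where
    open ≤-Reasoning
    reorder : ∀ t u → 7 + (5 + (6 + t + 1) + u) ≡ 19 + (u + t)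
    reorder = solve-∀
    reorder′ : ∀ s u → 19 + (s + (7 + u)) ≡ 7 + (19 + s + u)
    reorder′ = solve-∀

-- Polynomial bounds on the number of steps

-- A single monomial is enough for `N ≥ 1`: in a sum, both exponents can be raised to a common one.
Polynomial : (ℕ → ℕ) → Set
Polynomial f = ∃₂ λ c d → ∀ N → .{{NonZero N}} → f N ≤ c * N ^ d

constant-poly : ∀ c → Polynomial (λ _ → c)
constant-poly c = c , 0 , λ _ → ≤-reflexive (sym (*-identityʳ c))

id-poly : Polynomial (λ N → N)
id-poly = 1 , 1 , λ N → ≤-reflexive (sym (trans (*-identityˡ _) (*-identityʳ N)))

infixl 6 _+-poly_
infixl 7 _*-poly_

_+-poly_ : ∀ {f g} → Polynomial f → Polynomial g → Polynomial (λ N → f N + g N)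
(c , d , p) +-poly (c′ , d′ , p′) = c + c′ , d + d′ , λ N →
  ≤-trans (+-mono-≤ (p N) (p′ N))
    (≤-trans
      (+-mono-≤ (*-monoʳ-≤ c (^-monoʳ-≤ N (m≤m+n d d′)))
                (*-monoʳ-≤ c′ (^-monoʳ-≤ N (m≤n+m d′ d))))
      (≤-reflexive (sym (*-distribʳ-+ (N ^ (d + d′)) c c′))))

_*-poly_ : ∀ {f g} → Polynomial f → Polynomial g → Polynomial (λ N → f N * g N)
(c , d , p) *-poly (c′ , d′ , p′) = c * c′ , d + d′ , λ N →
  ≤-trans (*-mono-≤ (p N) (p′ N))
    (≤-reflexive (trans (interchange c (N ^ d) c′ (N ^ d′))
      (cong (c * c′ *_) (sym (^-distribˡ-+-* N d d′)))))
  where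
  interchange : ∀ a b x y → a * b * (x * y) ≡ a * x * (b * y)
  interchange = solve-∀

steps-poly : ∀ {m} (e : Term m) → Polynomial (steps e)
steps-poly (var i)        = constant-poly (3 + 4 * toℕ i)
steps-poly nil            = constant-poly 1
steps-poly (e₁ ∙ e₂)      =
  constant-poly 1 +-poly (steps-poly e₁ +-poly steps-poly e₂)
steps-poly (fst e)        = constant-poly 2 +-poly steps-poly e
steps-poly (snd e)        = constant-poly 2 +-poly steps-poly e
steps-poly (cond e e₁ e₂) =
  constant-poly 3 +-poly
    (steps-poly e +-poly (steps-poly e₁ +-poly steps-poly e₂))
steps-poly (bind e₁ e₂)   =
  constant-poly 3 +-poly (steps-poly e₁ +-poly steps-poly e₂)
steps-poly (rec e₁ e₂ e₃) =
  constant-poly 11 +-poly (steps-poly e₁ +-poly (steps-poly e₂ +-poly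
    id-poly *-poly (constant-poly 19 +-poly steps-poly e₃)))

compile : Term 3 → Program 3
compile e = record
  { #functions = proj₁ (Rec-finite e)
  ; arity      = λ _ → 1
  ; body       = λ i → functions e ι (Inverse.to (proj₂ (Rec-finite e)) i)
  ; main       = bind (var 0F ∙ (var 1F ∙ (var 2F ∙ nil))) (code e ι)
  }
  where
  ι = Inverse.from (proj₂ (Rec-finite e))

compile-correct : ∀ {N e x} {ρ : Vec Tree 3} → N ∣ ρ ⊢ e ↦ x →
                  ∃[ t ] compile e ⟪ ρ ⟫⇓ x [ t ] × t ≤ 8 + steps e N
compile-correct {e = e} {ρ = _ ∷ _ ∷ _ ∷ []} d =
  let _ , r , b = Simulation.simulate _ _ ι implements d
  in _ , bind (var 0F ∙ (var 1F ∙ (var 2F ∙ nil))) r , +-monoʳ-≤ 8 b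
  where
  open Semantics (compile e)
  ι = Inverse.from (proj₂ (Rec-finite e))
  implements : ∀ r → functions e ι (Inverse.to (proj₂ (Rec-finite e)) (ι r)) ≡
                     functions e ι r
  implements r = cong (functions e ι)
    (Inverse.strictlyInverseˡ (proj₂ (Rec-finite e)) r)

-- Recursion schemes and basic operations on lists and numerals

⌜_⌝ᶠ : ∀ {n} → Fin n → Tree
⌜ i ⌝ᶠ = ⌜ toℕ i ⌝ℕ

module _ {N m : ℕ} {ρ : Vec Tree m} where

  -- `F` gives the recursive result on each suffix. The invariant `P` is inherited by tails and
  -- hands the step a length bound or a membership that is known for the whole list.
  list-loop : ∀ {A : Set} {enc : A → Tree} {z e}
              (F : List A → Tree) (P : List A → Set) →
              (∀ {x xs} → P (x ∷ xs) → P xs) → z ≡ F [] →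
              (∀ {x xs} → P (x ∷ xs) →
                N ∣ enc x ∷ ⌜ List.map enc xs ⌝* ∷ F xs ∷ ρ ⊢ e ↦ F (x ∷ xs)) →
              ∀ xs → P xs → Loop N ρ z e (length xs) ⌜ List.map enc xs ⌝* (F xs)
  list-loop F P tail refl s []       p = nil
  list-loop F P tail refl s (x ∷ xs) p = list-loop F P tail refl s xs (tail p) ∙ s p

  rec-list : ∀ {A : Set} {enc : A → Tree} {l z e} xs
             (F : List A → Tree) (P : List A → Set) →
             (∀ {x ys} → P (x ∷ ys) → P ys) → P xs → length xs ≤ N →
             N ∣ ρ ⊢ l ↦ ⌜ List.map enc xs ⌝* → N ∣ ρ ⊢ z ↦ F [] →
             (∀ {x ys} → P (x ∷ ys) →
               N ∣ enc x ∷ ⌜ List.map enc ys ⌝* ∷ F ys ∷ ρ ⊢ e ↦ F (x ∷ ys)) →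
             N ∣ ρ ⊢ rec l z e ↦ F xs
  rec-list xs F P tail p b l z s = rec l z (list-loop F P tail refl s xs p) b

  rec-∈ : ∀ {A : Set} {enc : A → Tree} {l z e} xs (F : List A → Tree) →
          length xs ≤ N → N ∣ ρ ⊢ l ↦ ⌜ List.map enc xs ⌝* → N ∣ ρ ⊢ z ↦ F [] →
          (∀ {x ys} → x ∈ xs →
            N ∣ enc x ∷ ⌜ List.map enc ys ⌝* ∷ F ys ∷ ρ ⊢ e ↦ F (x ∷ ys)) →
          N ∣ ρ ⊢ rec l z e ↦ F xs
  rec-∈ xs F b l z s =
    rec-list xs F (λ ys → ∀ {y} → y ∈ ys → y ∈ xs) (λ p → p ∘ there) id b l z
      (λ p → s (p (here refl)))

  rec-ℕ : ∀ {l z e j} (F : ℕ → Tree) → j ≤ N →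
          N ∣ ρ ⊢ l ↦ ⌜ j ⌝ℕ → N ∣ ρ ⊢ z ↦ F 0 →
          (∀ {i} → i < j → N ∣ nil ∷ ⌜ i ⌝ℕ ∷ F i ∷ ρ ⊢ e ↦ F (suc i)) →
          N ∣ ρ ⊢ rec l z e ↦ F j
  rec-ℕ {z = z} {e} {j} F b l z↦ s = rec l z↦ (go j ≤-refl) b
    where
    go : ∀ i → i ≤ j → Loop N ρ (F 0) e i ⌜ i ⌝ℕ (F i)
    go zero    _   = nil
    go (suc i) i<j = go i (<⇒≤ i<j) ∙ s i<j

  cond-↦ : ∀ {A : Set} {enc : A → Tree} {e e₁ e₂ b x y} →
           N ∣ ρ ⊢ e ↦ ⌜ b ⌝ᵇ → N ∣ ρ ⊢ e₁ ↦ enc x → N ∣ ρ ⊢ e₂ ↦ enc y →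
           N ∣ ρ ⊢ cond e e₁ e₂ ↦ enc (if b then x else y)
  cond-↦ {b = false} e e₁ e₂ = cond-nil e e₂
  cond-↦ {b = true}  e e₁ e₂ = cond-∙ e e₁

trueᵗ : ∀ {m} → Term m
trueᵗ = nil ∙ nil

andᵗ : ∀ {m} → Term m → Term m → Term m
andᵗ e₁ e₂ = cond e₁ e₂ nil

anyᵗ allᵗ mapᵗ : ∀ {m} → Term m → Term (3 + m) → Term m
anyᵗ l e = rec l nil (cond e trueᵗ (var 2F))
allᵗ l e = rec l trueᵗ (cond e (var 2F) nil)
mapᵗ l e = rec l nil (e ∙ var 2F)

-- `ltᵗ` strips one successor of the second numeral per successor of the first and tests whether
-- anything is left, `snd` being harmless on `nil`. Only the first argument is recursed on, so the
-- second may be as large as the bound `L`. `eqᵗ` recurses on both.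
appendᵗ plusᵗ ltᵗ leᵗ eqᵗ indexᵗ : ∀ {m} → Term m → Term m → Term m
appendᵗ e₁ e₂ = rec e₁ e₂ (var 0F ∙ var 2F)
plusᵗ e₁ e₂   = rec e₁ e₂ (nil ∙ var 2F)
ltᵗ e₁ e₂     = cond (rec e₁ e₂ (snd (var 2F))) trueᵗ nil
leᵗ e₁ e₂     = ltᵗ e₁ (nil ∙ e₂)
eqᵗ e₁ e₂     = andᵗ (leᵗ e₁ e₂) (leᵗ e₂ e₁)
indexᵗ l i    = fst (rec i l (snd (var 2F)))

-- The second list is given by a variable because it is used under binders.
crossᵗ : ∀ {m} → Term m → Fin m → Term m
crossᵗ l v =
  rec l nil (appendᵗ (mapᵗ (var (suc (suc (suc v)))) (var 3F ∙ var 0F)) (var 2F))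

numeralᵗ : ∀ {m} → ℕ → Term m
numeralᵗ zero    = nil
numeralᵗ (suc i) = nil ∙ numeralᵗ i

_≤?ᵇ_ _=?ᵇ_ : ℕ → ℕ → Bool
i ≤?ᵇ j = i <ᵇ suc j
i =?ᵇ j = i ≤?ᵇ j ∧ j ≤?ᵇ i

module _ {N m : ℕ} {ρ : Vec Tree m} where

  true-↦ : N ∣ ρ ⊢ trueᵗ ↦ ⌜ true ⌝ᵇ
  true-↦ = nil ∙ nil

  and-↦ : ∀ {e₁ e₂ a b} → N ∣ ρ ⊢ e₁ ↦ ⌜ a ⌝ᵇ → N ∣ ρ ⊢ e₂ ↦ ⌜ b ⌝ᵇ →
          N ∣ ρ ⊢ andᵗ e₁ e₂ ↦ ⌜ a ∧ b ⌝ᵇ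
  and-↦ {a = false} d₁ d₂ = cond-nil d₁ nil
  and-↦ {a = true}  d₁ d₂ = cond-∙ d₁ d₂

  module _ {A : Set} {enc : A → Tree} {l : Term m} {e : Term (3 + m)}
    (xs : List A) where

    any-↦ : ∀ {p : A → Bool} → length xs ≤ N → N ∣ ρ ⊢ l ↦ ⌜ List.map enc xs ⌝* →
            (∀ {x t r} → x ∈ xs → N ∣ enc x ∷ t ∷ r ∷ ρ ⊢ e ↦ ⌜ p x ⌝ᵇ) →
            N ∣ ρ ⊢ anyᵗ l e ↦ ⌜ any p xs ⌝ᵇ
    any-↦ {p} b l s =
      rec-∈ xs (⌜_⌝ᵇ ∘ any p) b l nil λ {x} x∈xs → step {p x} (s x∈xs)
      where
      step : ∀ {a c x t} → N ∣ x ∷ t ∷ ⌜ c ⌝ᵇ ∷ ρ ⊢ e ↦ ⌜ a ⌝ᵇ →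
             N ∣ x ∷ t ∷ ⌜ c ⌝ᵇ ∷ ρ ⊢ cond e trueᵗ (var 2F) ↦ ⌜ a ∨ c ⌝ᵇ
      step {false} d = cond-nil d (var refl)
      step {true}  d = cond-∙ d (nil ∙ nil)

    all-↦ : ∀ {p : A → Bool} → length xs ≤ N → N ∣ ρ ⊢ l ↦ ⌜ List.map enc xs ⌝* →
            (∀ {x t r} → x ∈ xs → N ∣ enc x ∷ t ∷ r ∷ ρ ⊢ e ↦ ⌜ p x ⌝ᵇ) →
            N ∣ ρ ⊢ allᵗ l e ↦ ⌜ all p xs ⌝ᵇ
    all-↦ {p} b l s =
      rec-∈ xs (⌜_⌝ᵇ ∘ all p) b l true-↦ λ {x} x∈xs → step {p x} (s x∈xs)
      where
      step : ∀ {a c x t} → N ∣ x ∷ t ∷ ⌜ c ⌝ᵇ ∷ ρ ⊢ e ↦ ⌜ a ⌝ᵇ →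
             N ∣ x ∷ t ∷ ⌜ c ⌝ᵇ ∷ ρ ⊢ cond e (var 2F) nil ↦ ⌜ a ∧ c ⌝ᵇ
      step {false} d = cond-nil d nil
      step {true}  d = cond-∙ d (var refl)

    map-↦ : ∀ {f : A → Tree} → length xs ≤ N → N ∣ ρ ⊢ l ↦ ⌜ List.map enc xs ⌝* →
            (∀ {x t r} → x ∈ xs → N ∣ enc x ∷ t ∷ r ∷ ρ ⊢ e ↦ f x) →
            N ∣ ρ ⊢ mapᵗ l e ↦ ⌜ List.map f xs ⌝*
    map-↦ {f} b l s =
      rec-∈ xs (⌜_⌝* ∘ List.map f) b l nil λ x∈xs → s x∈xs ∙ var refl

  append-↦ : ∀ {e₁ e₂} ts us → length ts ≤ N →
             N ∣ ρ ⊢ e₁ ↦ ⌜ ts ⌝* → N ∣ ρ ⊢ e₂ ↦ ⌜ us ⌝* →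
             N ∣ ρ ⊢ appendᵗ e₁ e₂ ↦ ⌜ ts ++ us ⌝*
  append-↦ {e₁} ts us b d₁ d₂ =
    rec-∈ {enc = id} ts (λ xs → ⌜ xs ++ us ⌝*) b
      (subst (λ xs → N ∣ ρ ⊢ e₁ ↦ ⌜ xs ⌝*) (sym (map-id ts)) d₁)
      d₂ (λ _ → var refl ∙ var refl)

  plus-↦ : ∀ {e₁ e₂ i j} → i ≤ N → N ∣ ρ ⊢ e₁ ↦ ⌜ i ⌝ℕ → N ∣ ρ ⊢ e₂ ↦ ⌜ j ⌝ℕ →
           N ∣ ρ ⊢ plusᵗ e₁ e₂ ↦ ⌜ i + j ⌝ℕ
  plus-↦ {j = j} b d₁ d₂ = rec-ℕ (λ i → ⌜ i + j ⌝ℕ) b d₁ d₂ (λ _ → nil ∙ var refl)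

  lt-↦ : ∀ {e₁ e₂ i j} → i ≤ N → N ∣ ρ ⊢ e₁ ↦ ⌜ i ⌝ℕ → N ∣ ρ ⊢ e₂ ↦ ⌜ j ⌝ℕ →
         N ∣ ρ ⊢ ltᵗ e₁ e₂ ↦ ⌜ i <ᵇ j ⌝ᵇ
  lt-↦ {e₁} {e₂} {i} {j} b d₁ d₂ =
    test i j (rec-ℕ (λ i → ⌜ j ∸ i ⌝ℕ) b d₁ d₂ λ {i} _ → step i)
    where
    tail : ∀ k {x t} → N ∣ x ∷ t ∷ ⌜ k ⌝ℕ ∷ ρ ⊢ snd (var 2F) ↦ ⌜ pred k ⌝ℕ
    tail zero    = snd-nil (var refl)
    tail (suc k) = snd (var refl)
    step : ∀ i → N ∣ nil ∷ ⌜ i ⌝ℕ ∷ ⌜ j ∸ i ⌝ℕ ∷ ρ ⊢ snd (var 2F) ↦ ⌜ j ∸ suc i ⌝ℕ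
    step i rewrite sym (pred[m∸n]≡m∸[1+n] j i) = tail (j ∸ i)
    test : ∀ {e} i j → N ∣ ρ ⊢ e ↦ ⌜ j ∸ i ⌝ℕ →
           N ∣ ρ ⊢ cond e trueᵗ nil ↦ ⌜ i <ᵇ j ⌝ᵇ
    test zero    zero    d = cond-nil d nil
    test zero    (suc j) d = cond-∙ d true-↦
    test (suc i) zero    d = cond-nil d nil
    test (suc i) (suc j) d = test i j d

  le-↦ : ∀ {e₁ e₂ i j} → i ≤ N → N ∣ ρ ⊢ e₁ ↦ ⌜ i ⌝ℕ → N ∣ ρ ⊢ e₂ ↦ ⌜ j ⌝ℕ →
         N ∣ ρ ⊢ leᵗ e₁ e₂ ↦ ⌜ i ≤?ᵇ j ⌝ᵇ
  le-↦ b d₁ d₂ = lt-↦ b d₁ (nil ∙ d₂)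

  eq-↦ : ∀ {e₁ e₂ i j} → i ≤ N → j ≤ N →
         N ∣ ρ ⊢ e₁ ↦ ⌜ i ⌝ℕ → N ∣ ρ ⊢ e₂ ↦ ⌜ j ⌝ℕ →
         N ∣ ρ ⊢ eqᵗ e₁ e₂ ↦ ⌜ i =?ᵇ j ⌝ᵇ
  eq-↦ b c d₁ d₂ = and-↦ (le-↦ b d₁ d₂) (le-↦ c d₂ d₁)

  index-↦ : ∀ {l e n} {f : Fin n → Tree} {i} → n ≤ N →
            N ∣ ρ ⊢ l ↦ ⌜ List.tabulate f ⌝* → N ∣ ρ ⊢ e ↦ ⌜ i ⌝ᶠ →
            N ∣ ρ ⊢ indexᵗ l e ↦ f i
  index-↦ {n = n} {f} {i} n≤N d₁ d₂ =
    let t , eq = drop-tabulate f i in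
    fst (subst (λ x → N ∣ ρ ⊢ _ ↦ x) eq
      (rec-ℕ (λ j → dropᵀ j ⌜ List.tabulate f ⌝*) (≤-trans (<⇒≤ (toℕ<n i)) n≤N) d₂ d₁
        λ {j} _ → tail (dropᵀ j ⌜ List.tabulate f ⌝*)))
    where
    tailᵀ : Tree → Tree
    tailᵀ nil     = nil
    tailᵀ (x ∙ y) = y
    dropᵀ : ℕ → Tree → Tree
    dropᵀ zero    x = x
    dropᵀ (suc j) x = tailᵀ (dropᵀ j x)
    -- The recursion applies the last `tailᵀ` on the outside, whereas induction on the index removes
    -- the first element on the inside.
    drop-suc : ∀ j x y → dropᵀ (suc j) (x ∙ y) ≡ dropᵀ j y
    drop-suc zero    x y = refl
    drop-suc (suc j) x y = cong tailᵀ (drop-suc j x y)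
    drop-tabulate : ∀ {n} (f : Fin n → Tree) i →
                    ∃[ t ] dropᵀ (toℕ i) ⌜ List.tabulate f ⌝* ≡ f i ∙ t
    drop-tabulate f zero    = _ , refl
    drop-tabulate f (suc i) =
      let t , eq = drop-tabulate (f ∘ suc) i in t , trans (drop-suc (toℕ i) _ _) eq
    tail : ∀ y {x t} → N ∣ x ∷ t ∷ y ∷ ρ ⊢ snd (var 2F) ↦ tailᵀ y
    tail nil     = snd-nil (var refl)
    tail (_ ∙ _) = snd (var refl)

  numeral-↦ : ∀ i → N ∣ ρ ⊢ numeralᵗ i ↦ ⌜ i ⌝ℕ
  numeral-↦ zero    = nil
  numeral-↦ (suc i) = nil ∙ numeral-↦ i

module _ {N m : ℕ} {ρ : Vec Tree m} where

  cross-↦ : ∀ {A B C : Set} {encA : A → Tree} {encB : B → Tree} {encC : C → Tree}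
              {f : A → B → C} {l v} xs ys →
            (∀ x y → encC (f x y) ≡ encA x ∙ encB y) →
            length xs ≤ N → length ys ≤ N →
            N ∣ ρ ⊢ l ↦ ⌜ List.map encA xs ⌝* → lookup ρ v ≡ ⌜ List.map encB ys ⌝* →
            N ∣ ρ ⊢ crossᵗ l v ↦ ⌜ List.map encC (cartesianProductWith f xs ys) ⌝*
  cross-↦ {encA = encA} {encB} {encC} {f} xs ys enc-f b c d v≡ =
    rec-∈ xs (λ xs → ⌜ List.map encC (cartesianProductWith f xs ys) ⌝*) b d nil
      λ {x} {xs} _ → subst
        (λ ts → N ∣ encA x ∷ ⌜ List.map encA xs ⌝* ∷
                    ⌜ List.map encC (cartesianProductWith f xs ys) ⌝* ∷ ρ ⊢ _ ↦ ⌜ ts ⌝*)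
        (step x xs)
        (append-↦ (List.map (λ y → encA x ∙ encB y) ys)
          (List.map encC (cartesianProductWith f xs ys))
          (≤-trans (≤-reflexive (length-map _ ys)) c)
          (map-↦ {enc = encB} ys {f = λ y → encA x ∙ encB y} c (var v≡)
            (λ _ → var refl ∙ var refl))
          (var refl))
    where
    step : ∀ x xs → List.map (λ y → encA x ∙ encB y) ys ++
                    List.map encC (cartesianProductWith f xs ys) ≡
                    List.map encC (cartesianProductWith f (x ∷ xs) ys)
    step x xs = sym (trans (map-++ encC (List.map (f x) ys) _)
      (cong (_++ _) (trans (sym (map-∘ ys)) (map-cong (enc-f x) ys))))

-- The algorithm

-- (u , f , g) stands for the guess that the vertex of the path at distance g
-- from its end has distance at most f from u.
Triple : ℕ → Set
Triple n = Fin n × ℕ × ℕ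

⌜_⌝ᵗ : ∀ {n} → Triple n → Tree
⌜ u , f , g ⌝ᵗ = ⌜ u ⌝ᶠ ∙ (⌜ f ⌝ℕ ∙ ⌜ g ⌝ℕ)

⌜_⌝ᵗ* : ∀ {n} → List (Triple n) → Tree
⌜ A ⌝ᵗ* = ⌜ List.map ⌜_⌝ᵗ A ⌝*

-- Bounded search in the form of an iteration: the counter advances until `p` holds and then stays,
-- so the value is `j` if nothing below `j` satisfies `p`.
least : (ℕ → Bool) → ℕ → ℕ
least p zero    = 0
least p (suc j) = if p (least p j) then least p j else suc (least p j)

least≤ : ∀ p j → least p j ≤ j
least≤ p zero = z≤n
least≤ p (suc j) with p (least p j)
... | true  = m≤n⇒m≤1+n (least≤ p j)
... | false = s≤s (least≤ p j)

module Algorithm {n : ℕ} (G : Graph (Fin n)) (S : Subset n) where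

  modulator : List (Fin n)
  modulator = filterᵇ (lookup S) (allFin n)

  -- Chosen above every distance, so that `downFrom D` lists all candidates for a distance or a
  -- position.
  width : List (Fin n) → ℕ
  width []       = 5
  width (_ ∷ ss) = 2 + width ss

  D : ℕ
  D = width modulator

  -- Is there a walk of length i from u to x whose vertex at distance j from the
  -- end satisfies guard j, for all j?
  walkᵇ : (ℕ → Fin n → Bool) → ℕ → Fin n → Fin n → Bool
  walkᵇ guard zero    x u = guard 0 u ∧ (toℕ u =?ᵇ toℕ x)
  walkᵇ guard (suc i) x u =
    guard (suc i) u ∧ any (λ w → Graph.adj G u w ∧ walkᵇ guard i x w) (allFin n)

  -- This is the distance only if the distance is at most D.
  dist : Fin n → Fin n → ℕ
  dist u x = least (λ i → walkᵇ (λ _ _ → true) i x u) D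

  Small : Triple n → Set
  Small (_ , f , g) = f ≤ D × g ≤ D

  pairs : List (ℕ × ℕ)
  pairs = cartesianProductWith _,_ (downFrom D) (downFrom D)

  triples : List (Fin n) → List (Triple n)
  triples us = cartesianProductWith _,_ us pairs

  tuples : ℕ → List (List (Triple n))
  tuples zero    = [] ∷ []
  tuples (suc j) = cartesianProductWith _∷_ (triples (allFin n)) (tuples j)

  -- A modulator vertex is paired with each choice of `f` and `g`. The last four triples also range
  -- over all `f`, although the guess that succeeds has `f = 0` there: the uniform format costs only
  -- a factor `D` for each.
  guesses : List (Fin n) → List (List (Triple n))
  guesses []       = tuples 4
  guesses (s ∷ ss) = cartesianProductWith _∷_ (triples (s ∷ [])) (guesses ss)

  module _ (L : ℕ) (A : List (Triple n)) where

    coveredᵇ : Fin n → Bool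
    coveredᵇ w = any (λ (u , f , g) → (f + dist w u) ≤?ᵇ L) A

    -- The vertices that are not covered have to lie on the path.
    guardᵇ : Fin n → ℕ → Fin n → Bool
    guardᵇ x i v =
      all (λ (u , f , g) → if g =?ᵇ i then dist u v ≤?ᵇ f else true) A ∧
      all (λ w → if coveredᵇ w then true else
                 if dist w x =?ᵇ i then toℕ w =?ᵇ toℕ v else true) (allFin n)

    -- Any walk of length `dist u x` is shortest. The guard tests a triple or an uncovered vertex
    -- only at its own position, so the remaining conjuncts make sure that these positions occur on
    -- the walk.
    acceptᵇ : Fin n → Fin n → Bool
    acceptᵇ x u =
      walkᵇ (guardᵇ x) (dist u x) x u ∧
      (all (λ (_ , _ , g) → g ≤?ᵇ dist u x) A ∧
       all (λ w → if coveredᵇ w then true else dist w x ≤?ᵇ dist u x) (allFin n))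

  answer : ℕ → Bool
  answer L = any (λ A → any (λ x → any (acceptᵇ L A x) (allFin n)) (allFin n))
                 (guesses modulator)

  decideᵇ : ℤ → Bool
  decideᵇ (ℤ.+ L)    = answer L
  decideᵇ ℤ.-[1+ _ ] = false

-- The algorithm as a term

-- The variables holding the adjacency matrix, the list of the vertices, and the
-- numbers D and L.
record Inputs (m : ℕ) : Set where
  constructor inputs
  field graph verts diam bound : Fin m

open Inputs

shift : ∀ {m} → Inputs m → Inputs (suc m)
shift (inputs g vs d l) = inputs (suc g) (suc vs) (suc d) (suc l)

shift³ : ∀ {m} → Inputs m → Inputs (3 + m)
shift³ = shift ∘ shift ∘ shift

↑³ : ∀ {m} → Fin m → Fin (3 + m)
↑³ i = suc (suc (suc i))

pattern 4F = suc 3F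
pattern 5F = suc 4F
pattern 6F = suc 5F
pattern 7F = suc 6F
pattern 8F = suc 7F
pattern 9F = suc 8F

adjᵗ : ∀ {m} → Inputs m → Fin m → Fin m → Term m
adjᵗ I u v = indexᵗ (indexᵗ (var (graph I)) (var u)) (var v)

-- The table of walkᵇ guard i x.  In guard₀, variable 0 is the vertex; in guard₊,
-- moreover variable 4 is the predecessor of the level.
walksᵗ : ∀ {m} → Inputs m → Term m → Fin m → Term (3 + m) → Term (6 + m) → Term m
walksᵗ I i x guard₀ guard₊ =
  rec i
    (mapᵗ (var (verts I)) (andᵗ guard₀ (eqᵗ (var 0F) (var (↑³ x)))))
    (mapᵗ (var (verts (shift³ I))) (andᵗ guard₊
      (anyᵗ (var (verts (shift³ (shift³ I))))
        (andᵗ (adjᵗ (shift³ (shift³ (shift³ I))) 3F 0F)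
              (indexᵗ (var 8F) (var 0F))))))

distᵗ : ∀ {m} → Inputs m → Fin m → Fin m → Term m
distᵗ I u x =
  rec (var (diam I)) nil
    (cond (indexᵗ (walksᵗ (shift³ I) (var 2F) (↑³ x) trueᵗ trueᵗ) (var (↑³ u)))
      (var 2F) (nil ∙ var 2F))

coveredᵗ : ∀ {m} → Inputs m → Fin m → Fin m → Term m
coveredᵗ I A w =
  anyᵗ (var A)
    (bind (fst (var 0F))
      (leᵗ (plusᵗ (fst (snd (var 1F))) (distᵗ (shift (shift³ I)) (suc (↑³ w)) 0F))
        (var (suc (↑³ (bound I))))))

guardᵗ : ∀ {m} → Inputs m → Fin m → Fin m → Fin m → Fin m → Term m
guardᵗ I A x i v =
  andᵗ
    (allᵗ (var A)
      (cond (eqᵗ (snd (snd (var 0F))) (var (↑³ i)))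
        (bind (fst (var 0F))
          (leᵗ (distᵗ (shift (shift³ I)) 0F (suc (↑³ v))) (fst (snd (var 1F)))))
        trueᵗ))
    (allᵗ (var (verts I))
      (cond (coveredᵗ (shift³ I) (↑³ A) 0F) trueᵗ
        (cond (eqᵗ (distᵗ (shift³ I) 0F (↑³ x)) (var (↑³ i)))
          (eqᵗ (var 0F) (var (↑³ v))) trueᵗ)))

acceptᵗ : ∀ {m} → Inputs m → Fin m → Fin m → Fin m → Term m
acceptᵗ I A x u =
  bind (distᵗ I u x)
    (andᵗ
      (indexᵗ
        (walksᵗ (shift I) (var 0F) (suc x)
          -- `guardᵗ` expects the level in a variable. It is bound here to 0 and below to the
          -- successor of variable 4, which moves the vertex to variable 1 in both cases.
          (bind nil (guardᵗ (shift (shift³ (shift I))) (5+ A) (5+ x) 0F 1F))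
          (bind (nil ∙ var 4F)
            (guardᵗ (shift (shift³ (shift³ (shift I)))) (8+ A) (8+ x) 0F 1F)))
        (var (suc u)))
      (andᵗ
        (allᵗ (var (suc A)) (leᵗ (snd (snd (var 0F))) (var 3F)))
        (allᵗ (var (verts (shift I)))
          (cond (coveredᵗ (shift³ (shift I)) (↑³ (suc A)) 0F) trueᵗ
            (leᵗ (distᵗ (shift³ (shift I)) 0F (↑³ (suc x))) (var 3F))))))
  where
  5+_ : ∀ {m} → Fin m → Fin (5 + m)
  5+ i = suc (↑³ (suc i))
  8+_ : ∀ {m} → Fin m → Fin (8 + m)
  8+ i = suc (↑³ (↑³ (suc i)))

-- The comments give the environment of the next line.
prepareᵗ : Term 11 → Term 3
prepareᵗ e =
  -- G ∷ S ∷ ℓ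
  bind (rec (var 0F) nil (nil ∙ mapᵗ (var 2F) (nil ∙ var 0F)))
  -- vertices ∷ G ∷ S ∷ ℓ
  (bind (rec (var 0F) nil
    (cond (indexᵗ (var 5F) (var 0F)) (var 0F ∙ var 2F) (var 2F)))
  -- modulator ∷ vertices ∷ G ∷ S ∷ ℓ
  (bind (rec (var 0F) (numeralᵗ 5) (nil ∙ (nil ∙ var 2F)))
  -- D ∷ modulator ∷ vertices ∷ G ∷ S ∷ ℓ
  (bind (rec (var 0F) nil (var 1F ∙ var 2F))
  (bind (crossᵗ (var 0F) 0F)
  -- pairs ∷ range ∷ D ∷ modulator ∷ vertices ∷ G ∷ S ∷ ℓ
  (bind (crossᵗ (var 4F) 0F)
  -- triples ∷ pairs ∷ range ∷ D ∷ modulator ∷ vertices ∷ G ∷ S ∷ ℓ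
  (bind (rec (var 4F) (rec (numeralᵗ 4) (nil ∙ nil) (crossᵗ (var 3F) 2F))
          (bind (crossᵗ (var 0F ∙ nil) 4F) (crossᵗ (var 0F) 3F)))
  -- guesses ∷ triples ∷ pairs ∷ range ∷ D ∷ modulator ∷ vertices ∷ G ∷ S ∷ ℓ
  (bind (snd (var 9F)) e)))))))

algorithm : Term 3
algorithm = prepareᵗ
  (cond (fst (var (suc 9F))) nil
    (anyᵗ (var 1F) (anyᵗ (var (↑³ 7F)) (anyᵗ (var (↑³ (↑³ 7F)))
      (acceptᵗ (shift³ (shift³ (shift³ (inputs 8F 7F 5F 0F)))) 6F 3F 0F)))))

-- Evaluation of the term, given the tables it needs

index-allFin-↦ : ∀ {N m n l e} {ρ : Vec Tree m} (f : Fin n → Tree) i → n ≤ N →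
                 N ∣ ρ ⊢ l ↦ ⌜ List.map f (allFin n) ⌝* → N ∣ ρ ⊢ e ↦ ⌜ i ⌝ᶠ →
                 N ∣ ρ ⊢ indexᵗ l e ↦ f i
index-allFin-↦ f i b d₁ d₂ =
  index-↦ b (subst (λ ts → _ ∣ _ ⊢ _ ↦ ⌜ ts ⌝*) (map-tabulate id f) d₁) d₂

-- The assumption on `D + D` is for `coveredᵗ`, which recurses along `f + dist w u`; both summands
-- are at most `D`.
module Evaluation {n : ℕ} (G : Graph (Fin n)) (S : Subset n) (L : ℕ)
  {N : ℕ} (n≤N : n ≤ N) (D+D≤N : Algorithm.D G S + Algorithm.D G S ≤ N) where

  open Algorithm G S

  D≤N : D ≤ N
  D≤N = ≤-trans (m≤m+n D D) D+D≤N

  allFin≤N : length (allFin n) ≤ N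
  allFin≤N = ≤-trans (≤-reflexive (length-tabulate {n = n} id)) n≤N

  toℕ≤N : ∀ (u : Fin n) → toℕ u ≤ N
  toℕ≤N u = ≤-trans (<⇒≤ (toℕ<n u)) n≤N

  -- `Holds (shift I) (x ∷ ρ)` computes to `Holds I ρ`, so one proof serves under all binders.
  Holds : ∀ {m} → Inputs m → Vec Tree m → Set
  Holds I ρ =
    lookup ρ (graph I) ≡ ⌜ G ⌝ᴳ ×
    lookup ρ (verts I) ≡ ⌜ List.map ⌜_⌝ᶠ (allFin n) ⌝* ×
    lookup ρ (diam I) ≡ ⌜ D ⌝ℕ ×
    lookup ρ (bound I) ≡ ⌜ L ⌝ℕ

  module _ {m} {ρ : Vec Tree m} (I : Inputs m) (H : Holds I ρ) where

    adj-↦ : ∀ {i j} u v → lookup ρ i ≡ ⌜ u ⌝ᶠ → lookup ρ j ≡ ⌜ v ⌝ᶠ →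
            N ∣ ρ ⊢ adjᵗ I i j ↦ ⌜ Graph.adj G u v ⌝ᵇ
    adj-↦ u v u≡ v≡ =
      index-↦ {f = λ v → ⌜ Graph.adj G u v ⌝ᵇ} {v} n≤N
        (index-↦ {f = λ u → ⌜ List.tabulate (λ v → ⌜ Graph.adj G u v ⌝ᵇ) ⌝*} {u} n≤N
          (var (proj₁ H)) (var u≡))
        (var v≡)

    any-verts-↦ : ∀ {e} (p : Fin n → Bool) →
                  (∀ {t r} u → N ∣ ⌜ u ⌝ᶠ ∷ t ∷ r ∷ ρ ⊢ e ↦ ⌜ p u ⌝ᵇ) →
                  N ∣ ρ ⊢ anyᵗ (var (verts I)) e ↦ ⌜ any p (allFin n) ⌝ᵇ
    any-verts-↦ p d = any-↦ {enc = ⌜_⌝ᶠ} (allFin n) {p} allFin≤N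
      (var (proj₁ (proj₂ H))) (λ {u} _ → d u)

    all-verts-↦ : ∀ {e} (p : Fin n → Bool) →
                  (∀ {t r} u → N ∣ ⌜ u ⌝ᶠ ∷ t ∷ r ∷ ρ ⊢ e ↦ ⌜ p u ⌝ᵇ) →
                  N ∣ ρ ⊢ allᵗ (var (verts I)) e ↦ ⌜ all p (allFin n) ⌝ᵇ
    all-verts-↦ p d = all-↦ {enc = ⌜_⌝ᶠ} (allFin n) {p} allFin≤N
      (var (proj₁ (proj₂ H))) (λ {u} _ → d u)

    map-verts-↦ : ∀ {e} (f : Fin n → Tree) →
                  (∀ {t r} u → N ∣ ⌜ u ⌝ᶠ ∷ t ∷ r ∷ ρ ⊢ e ↦ f u) →
                  N ∣ ρ ⊢ mapᵗ (var (verts I)) e ↦ ⌜ List.map f (allFin n) ⌝*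
    map-verts-↦ f d = map-↦ {enc = ⌜_⌝ᶠ} (allFin n) {f} allFin≤N
      (var (proj₁ (proj₂ H))) (λ {u} _ → d u)

    eq-verts-↦ : ∀ {i j} (u v : Fin n) → lookup ρ i ≡ ⌜ u ⌝ᶠ → lookup ρ j ≡ ⌜ v ⌝ᶠ →
                 N ∣ ρ ⊢ eqᵗ (var i) (var j) ↦ ⌜ toℕ u =?ᵇ toℕ v ⌝ᵇ
    eq-verts-↦ u v u≡ v≡ =
      eq-↦ {i = toℕ u} {toℕ v} (toℕ≤N u) (toℕ≤N v) (var u≡) (var v≡)

  -- Each level is tabulated for all vertices at once. The recursive call of `walkᵇ`, which branches
  -- over all vertices, thereby becomes a lookup in the previous table.
  walks-↦ : ∀ {m} {ρ : Vec Tree m} I → Holds I ρ →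
            ∀ {e j guard₀ guard₊} guard i x → i ≤ N →
            N ∣ ρ ⊢ e ↦ ⌜ i ⌝ℕ → lookup ρ j ≡ ⌜ x ⌝ᶠ →
            (∀ {t r} u → N ∣ ⌜ u ⌝ᶠ ∷ t ∷ r ∷ ρ ⊢ guard₀ ↦ ⌜ guard 0 u ⌝ᵇ) →
            (∀ {k t r r′} u → k < i →
              N ∣ ⌜ u ⌝ᶠ ∷ t ∷ r ∷ nil ∷ ⌜ k ⌝ℕ ∷ r′ ∷ ρ ⊢ guard₊ ↦
                ⌜ guard (suc k) u ⌝ᵇ) →
            N ∣ ρ ⊢ walksᵗ I e j guard₀ guard₊ ↦
              ⌜ List.map (λ u → ⌜ walkᵇ guard i x u ⌝ᵇ) (allFin n) ⌝*
  walks-↦ I H guard i x i≤N d x≡ d₀ d₊ =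
    rec-ℕ (λ i → ⌜ List.map (λ u → ⌜ walkᵇ guard i x u ⌝ᵇ) (allFin n) ⌝*) i≤N d
      (map-verts-↦ I H (λ u → ⌜ walkᵇ guard 0 x u ⌝ᵇ) λ u →
        and-↦ (d₀ u) (eq-verts-↦ (shift³ I) H u x refl x≡))
      λ {k} k<i → map-verts-↦ (shift³ I) H (λ u → ⌜ walkᵇ guard (suc k) x u ⌝ᵇ) λ u →
        and-↦ (d₊ u k<i)
          (any-verts-↦ (shift³ (shift³ I)) H
            (λ w → Graph.adj G u w ∧ walkᵇ guard k x w) λ w →
            and-↦ (adj-↦ (shift³ (shift³ (shift³ I))) H u w refl refl)
              (index-allFin-↦ (λ u → ⌜ walkᵇ guard k x u ⌝ᵇ) w n≤N
                (var refl) (var refl)))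

  dist≤D : ∀ u x → dist u x ≤ D
  dist≤D u x = least≤ (λ i → walkᵇ (λ _ _ → true) i x u) D

  dist≤N : ∀ u x → dist u x ≤ N
  dist≤N u x = ≤-trans (dist≤D u x) D≤N

  dist-↦ : ∀ {m} {ρ : Vec Tree m} I → Holds I ρ → ∀ {i j} u x →
           lookup ρ i ≡ ⌜ u ⌝ᶠ → lookup ρ j ≡ ⌜ x ⌝ᶠ →
           N ∣ ρ ⊢ distᵗ I i j ↦ ⌜ dist u x ⌝ℕ
  dist-↦ I H {i} {j} u x u≡ x≡ =
    rec-ℕ (λ j → ⌜ least p j ⌝ℕ) D≤N (var (proj₁ (proj₂ (proj₂ H)))) nil λ {k} k<D →
      cond-↦ {enc = ⌜_⌝ℕ} {b = p (least p k)}
        (index-allFin-↦ (λ u → ⌜ walkᵇ (λ _ _ → true) (least p k) x u ⌝ᵇ) u n≤N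
          (walks-↦ (shift³ I) H {j = ↑³ j} (λ _ _ → true) (least p k) x
            (≤-trans (least≤ p k) (≤-trans (<⇒≤ k<D) D≤N)) (var refl) x≡
            (λ _ → true-↦) (λ _ _ → true-↦))
          (var u≡))
        (var refl) (nil ∙ var refl)
    where
    p : ℕ → Bool
    p i = walkᵇ (λ _ _ → true) i x u

  module _ (A : List (Triple n)) (A≤N : length A ≤ N)
    (small : ∀ {a} → a ∈ A → Small a) where

    covered-↦ : ∀ {m} {ρ : Vec Tree m} I → Holds I ρ → ∀ {i j} w →
                lookup ρ i ≡ ⌜ A ⌝ᵗ* → lookup ρ j ≡ ⌜ w ⌝ᶠ →
                N ∣ ρ ⊢ coveredᵗ I i j ↦ ⌜ coveredᵇ L A w ⌝ᵇ
    covered-↦ I H w A≡ w≡ =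
      any-↦ {enc = ⌜_⌝ᵗ} A {λ (u , f , g) → (f + dist w u) ≤?ᵇ L} A≤N (var A≡)
        λ {(u , f , g)} a∈A → let f≤D , g≤D = small a∈A in
        bind (fst (var refl))
          (le-↦ {i = f + dist w u} {L} (≤-trans (+-mono-≤ f≤D (dist≤D w u)) D+D≤N)
            (plus-↦ {i = f} {dist w u} (≤-trans f≤D D≤N) (fst (snd (var refl)))
              (dist-↦ (shift (shift³ I)) H w u w≡ refl))
            (var (proj₂ (proj₂ (proj₂ H)))))

    guard-↦ : ∀ {m} {ρ : Vec Tree m} I → Holds I ρ →
              ∀ {A′ x′ i′ v′} x i v → i ≤ N →
              lookup ρ A′ ≡ ⌜ A ⌝ᵗ* → lookup ρ x′ ≡ ⌜ x ⌝ᶠ →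
              lookup ρ i′ ≡ ⌜ i ⌝ℕ → lookup ρ v′ ≡ ⌜ v ⌝ᶠ →
              N ∣ ρ ⊢ guardᵗ I A′ x′ i′ v′ ↦ ⌜ guardᵇ L A x i v ⌝ᵇ
    guard-↦ I H {A′} {x′} x i v i≤N A≡ x≡ i≡ v≡ = and-↦
      (all-↦ {enc = ⌜_⌝ᵗ} A
        {λ (u , f , g) → if g =?ᵇ i then dist u v ≤?ᵇ f else true} A≤N (var A≡)
        λ {(u , f , g)} a∈A → let f≤D , g≤D = small a∈A in
        cond-↦ {enc = ⌜_⌝ᵇ} {b = g =?ᵇ i}
          (eq-↦ {i = g} {i} (≤-trans g≤D D≤N) i≤N (snd (snd (var refl))) (var i≡))
          (bind (fst (var refl))
            (le-↦ {i = dist u v} {f} (dist≤N u v)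
              (dist-↦ (shift (shift³ I)) H u v refl v≡) (fst (snd (var refl)))))
          true-↦)
      (all-verts-↦ I H
        (λ w → if coveredᵇ L A w then true else
               if dist w x =?ᵇ i then toℕ w =?ᵇ toℕ v else true) λ w →
        cond-↦ {enc = ⌜_⌝ᵇ} {b = coveredᵇ L A w}
          (covered-↦ (shift³ I) H {↑³ A′} w A≡ refl) true-↦
          (cond-↦ {enc = ⌜_⌝ᵇ} {b = dist w x =?ᵇ i}
            (eq-↦ {i = dist w x} {i} (dist≤N w x) i≤N
              (dist-↦ (shift³ I) H {j = ↑³ x′} w x refl x≡) (var i≡))
            (eq-verts-↦ (shift³ I) H w v refl v≡) true-↦))

    accept-↦ : ∀ {m} {ρ : Vec Tree m} I → Holds I ρ →
               ∀ {A′ x′ u′} x u → lookup ρ A′ ≡ ⌜ A ⌝ᵗ* →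
               lookup ρ x′ ≡ ⌜ x ⌝ᶠ → lookup ρ u′ ≡ ⌜ u ⌝ᶠ →
               N ∣ ρ ⊢ acceptᵗ I A′ x′ u′ ↦ ⌜ acceptᵇ L A x u ⌝ᵇ
    accept-↦ I H {A′} {x′} x u A≡ x≡ u≡ = bind (dist-↦ I H u x u≡ x≡) (and-↦
      (index-allFin-↦ (λ u′ → ⌜ walkᵇ (guardᵇ L A x) (dist u x) x u′ ⌝ᵇ) u n≤N
        (walks-↦ (shift I) H {j = suc x′} (guardᵇ L A x) (dist u x) x (dist≤N u x)
          (var refl) x≡
          (λ v → bind nil
            (guard-↦ (shift (shift³ (shift I))) H x 0 v z≤n A≡ x≡ refl refl))
          (λ {k} v k<d → bind (nil ∙ var refl)
            (guard-↦ (shift (shift³ (shift³ (shift I)))) H x (suc k) v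
              (≤-trans k<d (dist≤N u x)) A≡ x≡ refl refl)))
        (var u≡))
      (and-↦
        (all-↦ {enc = ⌜_⌝ᵗ} A {λ (_ , _ , g) → g ≤?ᵇ dist u x} A≤N (var A≡)
          λ {(u′ , f , g)} a∈A → le-↦ {i = g} {dist u x}
            (≤-trans (proj₂ (small a∈A)) D≤N) (snd (snd (var refl))) (var refl))
        (all-verts-↦ (shift I) H
          (λ w → if coveredᵇ L A w then true else dist w x ≤?ᵇ dist u x) λ w →
          cond-↦ {enc = ⌜_⌝ᵇ} {b = coveredᵇ L A w}
            (covered-↦ (shift³ (shift I)) H {↑³ (suc A′)} w A≡ refl) true-↦
            (le-↦ {i = dist w x} {dist u x} (dist≤N w x)
              (dist-↦ (shift³ (shift I)) H {j = ↑³ (suc x′)} w x refl x≡) (var refl)))))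

-- Sizes of the lists, and evaluation of the whole algorithm

length-cartesianProductWith : ∀ {A B C : Set} (f : A → B → C) xs ys →
  length (cartesianProductWith f xs ys) ≡ length xs * length ys
length-cartesianProductWith f []       ys = refl
length-cartesianProductWith f (x ∷ xs) ys =
  trans (length-++ (List.map (f x) ys))
    (cong₂ _+_ (length-map (f x) ys) (length-cartesianProductWith f xs ys))

filterᵇ-∷ : ∀ {A : Set} (p : A → Bool) x xs →
            filterᵇ p (x ∷ xs) ≡ (if p x then x ∷ filterᵇ p xs else filterᵇ p xs)
filterᵇ-∷ p x xs with p x
... | true  = refl
... | false = refl

toList-tabulate : ∀ {A : Set} {n} (f : A → Tree) (xs : Vec A n) →
                  List.map f (Vec.toList xs) ≡ List.tabulate (f ∘ lookup xs)
toList-tabulate f []       = refl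
toList-tabulate f (x ∷ xs) = cong (f x ∷_) (toList-tabulate f xs)

⌜_⌝ᶠ* : ∀ {n} → List (Fin n) → Tree
⌜ us ⌝ᶠ* = ⌜ List.map ⌜_⌝ᶠ us ⌝*

module Sizes {n : ℕ} (G : Graph (Fin n)) (S : Subset n) where

  open Algorithm G S

  width≡ : ∀ ss → width ss ≡ 5 + 2 * length ss
  width≡ []       = refl
  width≡ (s ∷ ss) = trans (cong (2 +_) (width≡ ss)) (reorder (length ss))
    where
    reorder : ∀ k → 2 + (5 + 2 * k) ≡ 5 + 2 * suc k
    reorder = solve-∀

  length-pairs : length pairs ≡ D * D
  length-pairs = trans (length-cartesianProductWith _,_ (downFrom D) (downFrom D))
    (cong₂ _*_ (length-downFrom D) (length-downFrom D))

  length-triples : ∀ us → length (triples us) ≡ length us * (D * D)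
  length-triples us = trans (length-cartesianProductWith _,_ us pairs)
    (cong (length us *_) length-pairs)

  length-tuples : ∀ j → length (tuples j) ≡ (n * (D * D)) ^ j
  length-tuples zero    = refl
  length-tuples (suc j) =
    trans (length-cartesianProductWith _∷_ (triples (allFin n)) (tuples j))
      (cong₂ _*_
        (trans (length-triples (allFin n))
          (cong (_* (D * D)) (length-tabulate {n = n} id)))
        (length-tuples j))

  length-guesses : ∀ ss → length (guesses ss) ≡ (D * D) ^ length ss * (n * (D * D)) ^ 4
  length-guesses []       = trans (length-tuples 4) (sym (*-identityˡ _))
  length-guesses (s ∷ ss) =
    trans (length-cartesianProductWith _∷_ (triples (s ∷ [])) (guesses ss))
      (trans (cong₂ _*_ (trans (length-triples (s ∷ [])) (*-identityˡ (D * D)))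
                        (length-guesses ss))
        (sym (*-assoc (D * D) _ _)))

  triples-∈ : ∀ us {u f g} → (u , f , g) ∈ triples us → f < D × g < D
  triples-∈ us a∈ with ∈-cartesianProductWith⁻ _,_ us pairs a∈
  ... | _ , _ , _ , p∈ , refl
    with ∈-cartesianProductWith⁻ _,_ (downFrom D) (downFrom D) p∈
  ... | _ , _ , f∈ , g∈ , refl = ∈-downFrom⁻ f∈ , ∈-downFrom⁻ g∈

  triples-small : ∀ us {a} → a ∈ triples us → Small a
  triples-small us a∈ = let f<D , g<D = triples-∈ us a∈ in <⇒≤ f<D , <⇒≤ g<D

  tuples-∈ : ∀ j {A} → A ∈ tuples j → length A ≡ j × All Small A
  tuples-∈ zero    (here refl) = refl , []
  tuples-∈ (suc j) A∈
    with ∈-cartesianProductWith⁻ _∷_ (triples (allFin n)) (tuples j) A∈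
  ... | a , A , a∈ , A∈ , refl = let l , small = tuples-∈ j A∈ in
    cong suc l , triples-small (allFin n) a∈ ∷ small

  guesses-∈ : ∀ ss {A} → A ∈ guesses ss → length A ≡ length ss + 4 × All Small A
  guesses-∈ []       A∈ = tuples-∈ 4 A∈
  guesses-∈ (s ∷ ss) A∈
    with ∈-cartesianProductWith⁻ _∷_ (triples (s ∷ [])) (guesses ss) A∈
  ... | a , A , a∈ , A∈ , refl = let l , small = guesses-∈ ss A∈ in
    cong suc l , triples-small (s ∷ []) a∈ ∷ small

  D≥5 : 5 ≤ D
  D≥5 = ≤-trans (m≤m+n 5 (2 * length modulator)) (≤-reflexive (sym (width≡ modulator)))

  instance
    D*D≢0 : NonZero (D * D)
    D*D≢0 = >-nonZero (*-mono-≤ (≤-trans (s≤s z≤n) D≥5) (≤-trans (s≤s z≤n) D≥5))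

  -- The list of guesses is the longest one that is recursed on; for `n ≥ 1` its length also
  -- dominates `n`, `D + D` and the lengths of all intermediate lists.
  N : ℕ
  N = length (guesses modulator)

  module _ .{{_ : NonZero n}} where

    instance
      n*D*D≢0 : NonZero (n * (D * D))
      n*D*D≢0 = m*n≢0 n (D * D)

    guesses-mono : ∀ s ss → length (guesses ss) ≤ length (guesses (s ∷ ss))
    guesses-mono s ss = ≤-trans (m≤n*m _ (D * D)) (≤-reflexive (sym
      (trans (length-cartesianProductWith _∷_ (triples (s ∷ [])) (guesses ss))
        (cong (_* length (guesses ss))
          (trans (length-triples (s ∷ [])) (*-identityˡ (D * D)))))))

    tuples4≤guesses : ∀ ss → length (tuples 4) ≤ length (guesses ss)
    tuples4≤guesses []       = ≤-refl
    tuples4≤guesses (s ∷ ss) = ≤-trans (tuples4≤guesses ss) (guesses-mono s ss)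

    tuples≤N : ∀ {j} → j ≤ 4 → length (tuples j) ≤ N
    tuples≤N {j} j≤4 = ≤-trans (≤-reflexive (length-tuples j))
      (≤-trans (^-monoʳ-≤ (n * (D * D)) j≤4)
        (≤-trans (≤-reflexive (sym (length-tuples 4))) (tuples4≤guesses modulator)))

    n*D*D≤N : n * (D * D) ≤ N
    n*D*D≤N = ≤-trans (≤-reflexive (trans (sym (*-identityʳ _)) (sym (length-tuples 1))))
      (tuples≤N (s≤s z≤n))

    n≤N : n ≤ N
    n≤N = ≤-trans (m≤m*n n (D * D)) n*D*D≤N

    D*D≤N : D * D ≤ N
    D*D≤N = ≤-trans (m≤n*m (D * D) n) n*D*D≤N

    D+D≤N : D + D ≤ N
    D+D≤N = ≤-trans (≤-trans (≤-reflexive (cong (_+_ D) (sym (+-identityʳ D))))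
      (*-monoˡ-≤ D (≤-trans (s≤s (s≤s z≤n)) D≥5))) D*D≤N

    D≤N : D ≤ N
    D≤N = ≤-trans (m≤m+n D D) D+D≤N

    length≤N : ∀ {A} → A ∈ guesses modulator → length A ≤ N
    length≤N {A} A∈ = begin
      length A                 ≡⟨ proj₁ (guesses-∈ modulator A∈) ⟩
      length modulator + 4     ≤⟨ +-mono-≤ (m≤m+n _ _) (n≤1+n 4) ⟩
      2 * length modulator + 5 ≡⟨ +-comm _ 5 ⟩
      5 + 2 * length modulator ≡⟨ width≡ modulator ⟨
      D                        ≤⟨ D≤N ⟩
      N                        ∎
      where open ≤-Reasoning

    ⌜_⌝ᵗ** : List (List (Triple n)) → Tree
    ⌜ As ⌝ᵗ** = ⌜ List.map ⌜_⌝ᵗ* As ⌝*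

    ⌜_⌝² : ℕ × ℕ → Tree
    ⌜ f , g ⌝² = ⌜ f ⌝ℕ ∙ ⌜ g ⌝ℕ

    range-length≤N : length (downFrom D) ≤ N
    range-length≤N = ≤-trans (≤-reflexive (length-downFrom D)) D≤N

    pairs-length≤N : length pairs ≤ N
    pairs-length≤N = ≤-trans (≤-reflexive length-pairs) D*D≤N

    allFin-length≤N : length (allFin n) ≤ N
    allFin-length≤N = ≤-trans (≤-reflexive (length-tabulate {n = n} id)) n≤N

    triples-length≤N : ∀ us → length us ≤ n → length (triples us) ≤ N
    triples-length≤N us b =
      ≤-trans (≤-reflexive (length-triples us)) (≤-trans (*-monoˡ-≤ (D * D) b) n*D*D≤N)

    modulator-length≤N : length modulator ≤ N
    modulator-length≤N = ≤-trans (length-filter _ (allFin n)) allFin-length≤N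

    -- Only the number of rows of the matrix matters: each row puts a new zero in front and
    -- increments the vertices listed so far.
    verts-↦ : ∀ {m} {ρ : Vec Tree m} {v} → lookup ρ v ≡ ⌜ G ⌝ᴳ →
              N ∣ ρ ⊢ rec (var v) nil (nil ∙ mapᵗ (var 2F) (nil ∙ var 0F)) ↦
                ⌜ allFin n ⌝ᶠ*
    verts-↦ {ρ = ρ} {v} G≡ =
      subst (λ k → N ∣ ρ ⊢ _ ↦ ⌜ allFin k ⌝ᶠ*) (length-tabulate row)
        (rec-list {enc = id} (List.tabulate row) (λ ts → ⌜ allFin (length ts) ⌝ᶠ*)
          (λ ts → length ts ≤ N) <⇒≤ rows≤N rows≤N
          (subst (λ ts → N ∣ ρ ⊢ var v ↦ ⌜ ts ⌝*)
            (sym (map-id (List.tabulate row))) (var G≡))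
          nil
          (λ {x} {ts} b → subst
            (λ us → N ∣ x ∷ ⌜ List.map id ts ⌝* ∷ ⌜ allFin (length ts) ⌝ᶠ* ∷ ρ ⊢
                      nil ∙ mapᵗ (var 2F) (nil ∙ var 0F) ↦ nil ∙ ⌜ us ⌝*)
            (map-suc (length ts))
            (nil ∙ map-↦ {enc = ⌜_⌝ᶠ} (allFin (length ts)) {λ u → nil ∙ ⌜ u ⌝ᶠ}
              (≤-trans (≤-reflexive (length-tabulate {n = length ts} id)) (<⇒≤ b))
              (var refl) (λ _ → nil ∙ var refl))))
      where
      row : Fin n → Tree
      row u = ⌜ List.tabulate (λ v → ⌜ Graph.adj G u v ⌝ᵇ) ⌝*
      map-suc : ∀ k → List.map (λ u → nil ∙ ⌜ u ⌝ᶠ) (allFin k) ≡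
                      List.map ⌜_⌝ᶠ (List.tabulate {n = k} suc)
      map-suc k = trans (map-tabulate id (λ u → nil ∙ ⌜ u ⌝ᶠ))
                        (sym (map-tabulate suc ⌜_⌝ᶠ))
      rows≤N : length (List.tabulate row) ≤ N
      rows≤N = ≤-trans (≤-reflexive (length-tabulate row)) n≤N

    modulator-↦ : ∀ {m} {ρ : Vec Tree m} {v s} → lookup ρ v ≡ ⌜ allFin n ⌝ᶠ* →
                  lookup ρ s ≡ ⌜ S ⌝ˢ →
                  N ∣ ρ ⊢ rec (var v) nil (cond (indexᵗ (var (↑³ s)) (var 0F))
                                             (var 0F ∙ var 2F) (var 2F)) ↦
                    ⌜ modulator ⌝ᶠ*
    modulator-↦ {ρ = ρ} v≡ s≡ =
      rec-∈ {enc = ⌜_⌝ᶠ} (allFin n) (λ us → ⌜ filterᵇ (lookup S) us ⌝ᶠ*)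
        allFin-length≤N (var v≡) nil
        λ {x} {us} _ → subst
          (λ vs → N ∣ ⌜ x ⌝ᶠ ∷ ⌜ us ⌝ᶠ* ∷ ⌜ filterᵇ (lookup S) us ⌝ᶠ* ∷ ρ ⊢ _ ↦ ⌜ vs ⌝ᶠ*)
          (sym (filterᵇ-∷ (lookup S) x us))
          (cond-↦ {enc = ⌜_⌝ᶠ*} {b = lookup S x}
            {x ∷ filterᵇ (lookup S) us} {filterᵇ (lookup S) us}
            (index-↦ {f = λ i → ⌜ lookup S i ⌝ᵇ} {x} n≤N
              (var (trans s≡ (cong ⌜_⌝* (toList-tabulate ⌜_⌝ᵇ S)))) (var refl))
            (var refl ∙ var refl) (var refl))

    guesses-↦ : ∀ {m} {ρ : Vec Tree m} {s t p} → lookup ρ s ≡ ⌜ modulator ⌝ᶠ* →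
                lookup ρ t ≡ ⌜ triples (allFin n) ⌝ᵗ* →
                lookup ρ p ≡ ⌜ List.map ⌜_⌝² pairs ⌝* →
                N ∣ ρ ⊢ rec (var s) (rec (numeralᵗ 4) (nil ∙ nil) (crossᵗ (var (↑³ t)) 2F))
                          (bind (crossᵗ (var 0F ∙ nil) (↑³ p)) (crossᵗ (var 0F) 3F)) ↦
                  ⌜ guesses modulator ⌝ᵗ**
    guesses-↦ s≡ t≡ p≡ =
      rec-list {enc = ⌜_⌝ᶠ} modulator (λ ss → ⌜ guesses ss ⌝ᵗ**)
        -- This passes to tails because each modulator vertex multiplies the number of guesses by
        -- `D * D ≥ 1`.
        (λ ss → length (guesses ss) ≤ N)
        (λ {s} {ss} → ≤-trans (guesses-mono s ss)) ≤-refl modulator-length≤N (var s≡)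
        (rec-ℕ (λ j → ⌜ tuples j ⌝ᵗ**) (≤-trans (n≤1+n 4) (≤-trans D≥5 D≤N))
          (numeral-↦ 4) (nil ∙ nil)
          λ {j} j<4 →
          cross-↦ {encA = ⌜_⌝ᵗ} {⌜_⌝ᵗ*} {⌜_⌝ᵗ*} {_∷_} (triples (allFin n))
            (tuples j) (λ _ _ → refl)
            (triples-length≤N (allFin n) (≤-reflexive (length-tabulate {n = n} id)))
            (tuples≤N (<⇒≤ j<4)) (var t≡) refl)
        λ {s} {ss} b → bind
          (cross-↦ {encA = ⌜_⌝ᶠ} {⌜_⌝²} {⌜_⌝ᵗ} {_,_} (s ∷ []) pairs (λ _ _ → refl)
            (≤-trans (>-nonZero⁻¹ n) n≤N) pairs-length≤N (var refl ∙ nil) p≡)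
          (cross-↦ {encA = ⌜_⌝ᵗ} {⌜_⌝ᵗ*} {⌜_⌝ᵗ*} {_∷_} (triples (s ∷ []))
            (guesses ss) (λ _ _ → refl)
            (triples-length≤N (s ∷ []) (>-nonZero⁻¹ n)) (≤-trans (guesses-mono s ss) b)
            (var refl) refl)

    D-↦ : ∀ {m} {ρ : Vec Tree m} {s} → lookup ρ s ≡ ⌜ modulator ⌝ᶠ* →
          N ∣ ρ ⊢ rec (var s) (numeralᵗ 5) (nil ∙ (nil ∙ var 2F)) ↦ ⌜ D ⌝ℕ
    D-↦ s≡ = rec-∈ {enc = ⌜_⌝ᶠ} modulator (⌜_⌝ℕ ∘ width) modulator-length≤N (var s≡)
      (numeral-↦ 5) (λ _ → nil ∙ (nil ∙ var refl))

    range-↦ : ∀ {m} {ρ : Vec Tree m} {d} → lookup ρ d ≡ ⌜ D ⌝ℕ →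
              N ∣ ρ ⊢ rec (var d) nil (var 1F ∙ var 2F) ↦ ⌜ List.map ⌜_⌝ℕ (downFrom D) ⌝*
    range-↦ d≡ = rec-ℕ (λ j → ⌜ List.map ⌜_⌝ℕ (downFrom j) ⌝*) D≤N (var d≡) nil
      (λ _ → var refl ∙ var refl)

    prepare-↦ : ∀ {x y z e} →
            N ∣ y ∷ ⌜ guesses modulator ⌝ᵗ** ∷ ⌜ triples (allFin n) ⌝ᵗ* ∷
                ⌜ List.map ⌜_⌝² pairs ⌝* ∷ ⌜ List.map ⌜_⌝ℕ (downFrom D) ⌝* ∷
                ⌜ D ⌝ℕ ∷ ⌜ modulator ⌝ᶠ* ∷ ⌜ allFin n ⌝ᶠ* ∷
                ⌜ G ⌝ᴳ ∷ ⌜ S ⌝ˢ ∷ (x ∙ y) ∷ [] ⊢ e ↦ z →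
            N ∣ ⌜ G ⌝ᴳ ∷ ⌜ S ⌝ˢ ∷ (x ∙ y) ∷ [] ⊢ prepareᵗ e ↦ z
    prepare-↦ d =
      bind (verts-↦ refl)
      (bind (modulator-↦ {s = 2F} refl refl)
      (bind (D-↦ refl)
      (bind (range-↦ refl)
      (bind (cross-↦ {encA = ⌜_⌝ℕ} {⌜_⌝ℕ} {⌜_⌝²} {_,_} (downFrom D) (downFrom D)
              (λ _ _ → refl) range-length≤N range-length≤N (var refl) refl)
      (bind (cross-↦ {encA = ⌜_⌝ᶠ} {⌜_⌝²} {⌜_⌝ᵗ} {_,_} (allFin n) pairs
              (λ _ _ → refl) allFin-length≤N pairs-length≤N (var refl) refl)
      (bind (guesses-↦ {t = 0F} {1F} refl refl refl)
      (bind (snd (var refl)) d)))))))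

    answer-↦ : ∀ L {m} {ρ : Vec Tree m} I → Evaluation.Holds G S L n≤N D+D≤N I ρ →
               ∀ {v} → lookup ρ v ≡ ⌜ guesses modulator ⌝ᵗ** →
               N ∣ ρ ⊢ anyᵗ (var v) (anyᵗ (var (verts (shift³ I)))
                         (anyᵗ (var (verts (shift³ (shift³ I))))
                           (acceptᵗ (shift³ (shift³ (shift³ I))) 6F 3F 0F))) ↦
                 ⌜ answer L ⌝ᵇ
    answer-↦ L I H v≡ =
      any-↦ {enc = ⌜_⌝ᵗ*} (guesses modulator) ≤-refl (var v≡) λ {A} A∈ →
      any-verts-↦ (shift³ I) H (λ x → any (acceptᵇ L A x) (allFin n)) λ x →
      any-verts-↦ (shift³ (shift³ I)) H (acceptᵇ L A x) λ u →
      accept-↦ A (length≤N A∈) (All.lookup (proj₂ (guesses-∈ modulator A∈)))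
        (shift³ (shift³ (shift³ I))) H x u refl refl refl
      where
      open Evaluation G S L n≤N D+D≤N

    algorithm-↦ : ∀ ℓ → N ∣ ⌜ G ⌝ᴳ ∷ ⌜ S ⌝ˢ ∷ ⌜ ℓ ⌝ℤ ∷ [] ⊢ algorithm ↦ ⌜ decideᵇ ℓ ⌝ᵇ
    algorithm-↦ (ℤ.+ L)    = prepare-↦ (cond-nil (fst (var refl))
      (answer-↦ L (inputs 8F 7F 5F 0F) (refl , refl , refl , refl) refl))
    algorithm-↦ ℤ.-[1+ _ ] = prepare-↦ (cond-∙ (fst (var refl)) nil)

-- Boolean tests and bounded search

∧⁺ : ∀ {a b} → T a × T b → T (a ∧ b)
∧⁺ = Equivalence.from T-∧

∧⁻ : ∀ {a b} → T (a ∧ b) → T a × T b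
∧⁻ = Equivalence.to T-∧

≤?ᵇ⇒≤ : ∀ i j → T (i ≤?ᵇ j) → i ≤ j
≤?ᵇ⇒≤ i j p = s≤s⁻¹ (<ᵇ⇒< i (suc j) p)

≤⇒≤?ᵇ : ∀ {i j} → i ≤ j → T (i ≤?ᵇ j)
≤⇒≤?ᵇ p = <⇒<ᵇ (s≤s p)

=?ᵇ⇒≡ : ∀ i j → T (i =?ᵇ j) → i ≡ j
=?ᵇ⇒≡ i j p = let q , r = ∧⁻ p in ≤-antisym (≤?ᵇ⇒≤ i j q) (≤?ᵇ⇒≤ j i r)

≡⇒=?ᵇ : ∀ {i j} → i ≡ j → T (i =?ᵇ j)
≡⇒=?ᵇ {i} refl = ∧⁺ {i ≤?ᵇ i} (≤⇒≤?ᵇ {i} ≤-refl , ≤⇒≤?ᵇ {i} ≤-refl)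

any-∃ : ∀ {A : Set} (p : A → Bool) xs → T (any p xs) → ∃[ x ] x ∈ xs × T (p x)
any-∃ p xs t = find (any⁻ p xs t)

-- Until the search stops, the counter equals the number of iterations. If it still equals `j` at
-- the end, nothing below `j` satisfies `p`, and the witness `m ≤ j` must be `j` itself.
least-minimum : ∀ (p : ℕ → Bool) {m} j → T (p m) → m ≤ j →
                IsMinimum (T ∘ p) (least p j)
least-minimum p {m} j pm m≤j = holds (proj₂ (invariant j)) , λ i pi →
  ≮⇒≥ λ i<l → proj₁ (invariant j) i i<l pi
  where
  invariant : ∀ j → (∀ i → i < least p j → ¬ T (p i)) ×
                    (T (p (least p j)) ⊎ least p j ≡ j)
  invariant zero = (λ _ ()) , inj₂ refl
  invariant (suc j) with p (least p j) in eq | invariant j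
  ... | true  | below , _           = below , inj₁ (subst T (sym eq) tt)
  ... | false | below , inj₁ ()
  ... | false | below , inj₂ least≡ = below′ , inj₂ (cong suc least≡)
    where
    below′ : ∀ i → i < suc (least p j) → ¬ T (p i)
    below′ i (s≤s i≤l) with m≤n⇒m<n∨m≡n i≤l
    ... | inj₁ i<l  = below i i<l
    ... | inj₂ refl = subst T eq
  holds : T (p (least p j)) ⊎ least p j ≡ j → T (p (least p j))
  holds (inj₁ pl) = pl
  holds (inj₂ l≡j) with m≤n⇒m<n∨m≡n (≤-trans m≤j (≤-reflexive (sym l≡j)))
  ... | inj₁ m<l  = contradiction pm (proj₁ (invariant j) m m<l)
  ... | inj₂ refl = pm

-- Walks and distances

module Walks {n : ℕ} (G : Graph (Fin n)) where

  open Graph G using (_~_)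

  private
    V : Set
    V = Fin n

  -- At W v i: v lies on W at distance i from its end.
  data At : ∀ {u x m} → Walk G u x m → V → ℕ → Set where
    head : ∀ {u x m} {W : Walk G u x m} → At W u m
    tail : ∀ {u v w x m i} {e : u ~ v} {W : Walk G v x m} → At W w i → At (e ∷ W) w i

  At-≤ : ∀ {u x m v i} {W : Walk G u x m} → At W v i → i ≤ m
  At-≤ head     = ≤-refl
  At-≤ (tail a) = m≤n⇒m≤1+n (At-≤ a)

  At-functional : ∀ {u x m v w i} {W : Walk G u x m} → At W v i → At W w i → v ≡ w
  At-functional head     head     = refl
  At-functional head     (tail b) = contradiction (At-≤ b) 1+n≰n
  At-functional (tail a) head     = contradiction (At-≤ a) 1+n≰n
  At-functional (tail a) (tail b) = At-functional a b

  At-total : ∀ {u x m} (W : Walk G u x m) {i} → i ≤ m → ∃[ v ] At W v i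
  At-total [ u ] z≤n = u , head
  At-total (_∷_ {u = u} e W) i≤1+m with m≤n⇒m<n∨m≡n i≤1+m
  ... | inj₁ i<1+m = let v , a = At-total W (s≤s⁻¹ i<1+m) in v , tail a
  ... | inj₂ refl  = u , head

  At⇒∈ : ∀ {u x m v i} {W : Walk G u x m} → At W v i → v ∈ vertices G W
  At⇒∈ {W = [ _ ]} head = here refl
  At⇒∈ {W = _ ∷ _} head = here refl
  At⇒∈ (tail a)         = there (At⇒∈ a)

  ∈⇒At : ∀ {u x m v} (W : Walk G u x m) → v ∈ vertices G W → ∃[ i ] At W v i
  ∈⇒At [ _ ]   (here refl) = _ , head
  ∈⇒At (e ∷ W) (here refl) = _ , head
  ∈⇒At (e ∷ W) (there v∈)  = let i , a = ∈⇒At W v∈ in i , tail a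

  suffix : ∀ {u x m v i} {W : Walk G u x m} → At W v i → Walk G v x i
  suffix {W = W} head = W
  suffix (tail a)     = suffix a

  prefix : ∀ {u x m v i} {W : Walk G u x m} → At W v i → ∃[ j ] Walk G u v j × j + i ≡ m
  prefix head             = 0 , [ _ ] , refl
  prefix (tail {e = e} a) = let j , W , eq = prefix a in suc j , e ∷ W , cong suc eq

  infixr 5 _◅◅_
  _◅◅_ : ∀ {u v w i j} → Walk G u v i → Walk G v w j → Walk G u w (i + j)
  [ _ ]   ◅◅ W′ = W′
  (e ∷ W) ◅◅ W′ = e ∷ (W ◅◅ W′)

  module _ (S : Subset n) where

    open Algorithm G S

    module _ (guard : ℕ → V → Bool) where

      walkᵇ-sound : ∀ i {x u} → T (walkᵇ guard i x u) →
                    Σ[ W ∈ Walk G u x i ] (∀ {v j} → At W v j → T (guard j v))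
      walkᵇ-sound zero {x} {u} t
        with g , u=x ← ∧⁻ {guard 0 u} t
        with refl ← toℕ-injective (=?ᵇ⇒≡ (toℕ u) (toℕ x) u=x)
        = [ u ] , λ { head → g }
      walkᵇ-sound (suc i) {x} {u} t
        with g , t′ ← ∧⁻ {guard (suc i) u} t
        with w , t″ ← Any.satisfied (any⁻ _ (allFin n) t′)
        with e , r ← ∧⁻ {Graph.adj G u w} t″
        = let W , gs = walkᵇ-sound i r in
          e ∷ W , λ { head → g ; (tail a) → gs a }

      walkᵇ-complete : ∀ {i x u} (W : Walk G u x i) →
                       (∀ {v j} → At W v j → T (guard j v)) →
                       T (walkᵇ guard i x u)
      walkᵇ-complete [ u ] g = ∧⁺ {guard 0 u} (g head , ≡⇒=?ᵇ {toℕ u} refl)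
      walkᵇ-complete {suc i} {x} {u} (_∷_ {v = v} e W) g = ∧⁺ {guard (suc i) u} (g head ,
        any⁺ (λ w → Graph.adj G u w ∧ walkᵇ guard i x w)
          (lose (∈-allFin v) (∧⁺ (e , walkᵇ-complete W (g ∘ tail)))))

module Metric {n : ℕ} (G : Graph (Fin n)) (δ : Fin n → Fin n → ℕ)
  (δ-distance : ∀ u v → Distance G u v (δ u v)) where

  open Graph G using (_~_)
  open Walks G

  δ-walk : ∀ u v → Walk G u v (δ u v)
  δ-walk u v = proj₁ (δ-distance u v)

  δ≤ : ∀ {u v m} → Walk G u v m → δ u v ≤ m
  δ≤ W = proj₂ (δ-distance _ _) _ W

  δ-refl : ∀ u → δ u u ≡ 0
  δ-refl u = n≤0⇒n≡0 (δ≤ [ u ])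

  δ≤1 : ∀ {u v} → (u ≢ v → u ~ v) → δ u v ≤ 1
  δ≤1 {u} {v} adjacent with u Fin.≟ v
  ... | yes refl = ≤-trans (≤-reflexive (δ-refl u)) z≤n
  ... | no u≢v   = δ≤ (adjacent u≢v ∷ [ v ])

  δ-triangle : ∀ u v w → δ u w ≤ δ u v + δ v w
  δ-triangle u v w = δ≤ (δ-walk u v ◅◅ δ-walk v w)

  Distance-unique : ∀ {u v m} → Distance G u v m → m ≡ δ u v
  Distance-unique (W , min) = ≤-antisym (min _ (δ-walk _ _)) (δ≤ W)

  tail-shortest : ∀ {u v x m} → u ~ v → Walk G v x m → δ u x ≡ suc m → δ v x ≡ m
  tail-shortest {v = v} {x} e W eq = ≤-antisym (δ≤ W)
    (s≤s⁻¹ (≤-trans (≤-reflexive (sym eq)) (δ≤ (e ∷ δ-walk v x))))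

  -- Suffixes of shortest walks are shortest. This lets a position on the path be identified from
  -- the vertex and the end alone.
  At-δ : ∀ {u x m v i} (W : Walk G u x m) → δ u x ≡ m → At W v i → i ≡ δ v x
  At-δ W       eq head     = sym eq
  At-δ (e ∷ W) eq (tail a) = At-δ W (tail-shortest e W eq) a

  -- A second occurrence of the first vertex would have a position smaller than its distance to the
  -- end.
  shortest-unique : ∀ {u x m} (W : Walk G u x m) → δ u x ≡ m → Unique (vertices G W)
  shortest-unique [ u ]   eq = [] ∷ []
  shortest-unique {u} {x} (_∷_ {m = m} e W) eq =
    All.tabulate (λ { v∈ refl → let i , a = ∈⇒At W v∈ in
      1+n≰n (≤-trans (≤-reflexive (trans (sym eq)
        (sym (At-δ W (tail-shortest e W eq) a)))) (At-≤ a)) })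
    ∷ shortest-unique W (tail-shortest e W eq)

-- The bound on all distances

lookup-injective : ∀ {A : Set} {xs : List A} → Unique xs →
                   ∀ {i j} → List.lookup xs i ≡ List.lookup xs j → i ≡ j
lookup-injective (x∉ ∷ u) {zero}  {zero}  eq = refl
lookup-injective (x∉ ∷ u) {zero}  {suc j} eq =
  contradiction eq (All.lookup x∉ (∈-lookup j))
lookup-injective (x∉ ∷ u) {suc i} {zero}  eq =
  contradiction (sym eq) (All.lookup x∉ (∈-lookup i))
lookup-injective (x∉ ∷ u) {suc i} {suc j} eq = cong suc (lookup-injective u eq)

unique-length-≤ : ∀ {A : Set} {xs ys : List A} → Unique xs →
                  (∀ {x} → x ∈ xs → x ∈ ys) → length xs ≤ length ys
unique-length-≤ {xs = xs} {ys} u xs⊆ys =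
  injective⇒≤ {f = λ i → Any.index (xs⊆ys (∈-lookup i))} λ {i} {j} eq →
    lookup-injective u (trans (lookup-index (xs⊆ys (∈-lookup i)))
      (trans (cong (List.lookup ys) eq) (sym (lookup-index (xs⊆ys (∈-lookup j))))))

bit : Bool → ℕ
bit true  = 1
bit false = 0

bit≤1 : ∀ b → bit b ≤ 1
bit≤1 true  = ≤-refl
bit≤1 false = z≤n

module Diameter {n : ℕ} (G : Graph (Fin n)) (δ : Fin n → Fin n → ℕ)
  (δ-distance : ∀ u v → Distance G u v (δ u v))
  (s c : Fin n → Bool)
  (clique : ∀ {u v} → T (c u) → T (c v) → u ≢ v → Graph._~_ G u v)
  (independent : ∀ {u v} → ¬ T (s u) → ¬ T (c u) → ¬ T (s v) → ¬ T (c v) →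
                 ¬ Graph._~_ G u v)
  where

  open Graph G using (_~_)
  open Walks G
  open Metric G δ δ-distance

  count : (Fin n → Bool) → ∀ {u x m} → Walk G u x m → ℕ
  count p [ u ]             = bit (p u)
  count p (_∷_ {u = u} _ W) = bit (p u) + count p W

  count-∨ : ∀ p q {u x m} (W : Walk G u x m) →
            count (λ v → p v ∨ q v) W ≤ count p W + count q W
  count-∨ p q = go
    where
    bit-∨ : ∀ a b → bit (a ∨ b) ≤ bit a + bit b
    bit-∨ true  b = s≤s z≤n
    bit-∨ false b = ≤-refl
    interchange : ∀ a b x y → (a + b) + (x + y) ≡ (a + x) + (b + y)
    interchange = solve-∀
    go : ∀ {u x m} (W : Walk G u x m) →
         count (λ v → p v ∨ q v) W ≤ count p W + count q W
    go [ u ] = bit-∨ (p u) (q u)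
    go (_∷_ {u = u} e W) = ≤-trans (+-mono-≤ (bit-∨ (p u) (q u)) (go W))
      (≤-reflexive (interchange (bit (p u)) (bit (q u)) (count p W) (count q W)))

  count≡length : ∀ p {u x m} (W : Walk G u x m) →
                 count p W ≡ length (filterᵇ p (vertices G W))
  count≡length p [ u ] with p u
  ... | true  = refl
  ... | false = refl
  count≡length p (_∷_ {u = u} e W) with p u
  ... | true  = cong suc (count≡length p W)
  ... | false = count≡length p W

  outside : ∀ {v} → s v ∨ c v ≡ false → ¬ T (s v) × ¬ T (c v)
  outside {v} eq with s v | c v
  ... | false | false = id , id

  -- Vertices in neither `s` nor `c` are pairwise nonadjacent, so each of them on the walk is
  -- preceded by a counted vertex unless it is the first; the last summand pays for that one.
  length≤2*count : ∀ {u x m} (W : Walk G u x m) →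
                   suc m ≤ 2 * count (λ v → s v ∨ c v) W + bit (not (s u ∨ c u))
  length≤2*count [ u ] with s u ∨ c u
  ... | true  = s≤s z≤n
  ... | false = s≤s z≤n
  length≤2*count {u} {m = suc m} (_∷_ {v = v} e W)
    with s u ∨ c u in eqᵤ | s v ∨ c v in eqᵥ | length≤2*count W
  ... | true  | b     | ih = begin
    2 + m                     ≤⟨ s≤s ih ⟩
    1 + (2 * k + bit (not b)) ≤⟨ s≤s (+-monoʳ-≤ (2 * k) (bit≤1 (not b))) ⟩
    1 + (2 * k + 1)           ≡⟨ reorder k ⟩
    2 * (1 + k) + 0           ∎
    where
    open ≤-Reasoning
    k = count (λ v → s v ∨ c v) W
    reorder : ∀ k → 1 + (2 * k + 1) ≡ 2 * (1 + k) + 0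
    reorder = solve-∀
  ... | false | true  | ih =
    ≤-trans (s≤s ih) (≤-reflexive (reorder (count (λ v → s v ∨ c v) W)))
    where
    reorder : ∀ k → 1 + (2 * k + 0) ≡ 2 * k + 1
    reorder = solve-∀
  ... | false | false | ih = contradiction e
    (independent (proj₁ (outside eqᵤ)) (proj₂ (outside eqᵤ))
                 (proj₁ (outside eqᵥ)) (proj₂ (outside eqᵥ)))

  -- Positions count from the end, so `m < i + k` places the vertex among the first `k` of the walk.
  count-c-≤ : ∀ {u x m} k (W : Walk G u x m) →
              (∀ {v i} → At W v i → T (c v) → m < i + k) → count c W ≤ k
  count-c-≤ {u} k [ u ] near with c u in eq
  ... | true  = near head (subst T (sym eq) tt)
  ... | false = z≤n
  count-c-≤ {u} k (e ∷ W) near with c u in eq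
  ... | false = count-c-≤ k W λ a cv → <-trans (n<1+n _) (near (tail a) cv)
  count-c-≤ {u} zero (e ∷ W) near | true =
    contradiction (near head (subst T (sym eq) tt))
      (<-irrefl (sym (+-identityʳ _)))
  count-c-≤ {u} (suc k) (e ∷ W) near | true =
    s≤s (count-c-≤ k W λ {_} {i} a cv →
      s≤s⁻¹ (≤-trans (near (tail a) cv) (≤-reflexive (+-suc i k))))

  -- After the first clique vertex of a shortest walk, any other is at distance at most 1 from it
  -- and hence comes immediately next.
  count-c≤2 : ∀ {u x m} (W : Walk G u x m) → δ u x ≡ m → count c W ≤ 2
  count-c≤2 [ u ] eq with c u
  ... | true  = s≤s z≤n
  ... | false = z≤n
  count-c≤2 {u} {x} (e ∷ W) eq with c u in cu
  ... | false = count-c≤2 W (tail-shortest e W eq)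
  ... | true  = s≤s (count-c-≤ 1 W λ {v} {i} a cv →
    ≤-trans (≤-reflexive (sym eq)) (≤-trans (δ-triangle u v x)
      (≤-trans (+-monoˡ-≤ (δ v x) (δ≤1 (clique (subst T (sym cu) tt) cv)))
        (≤-reflexive (trans (cong suc (sym (At-δ W (tail-shortest e W eq) a)))
                            (+-comm 1 i))))))

  δ-bound : ∀ {ss} → (∀ {v} → T (s v) → v ∈ ss) → ∀ u x → δ u x < 5 + 2 * length ss
  δ-bound {ss} complete u x = begin-strict
    δ u x
      <⟨ length≤2*count W ⟩
    2 * count (λ v → s v ∨ c v) W + bit (not (s u ∨ c u))
      ≤⟨ +-mono-≤ (*-monoʳ-≤ 2 (≤-trans (count-∨ s c W)
           (+-mono-≤ count-s (count-c≤2 W refl)))) (bit≤1 (not (s u ∨ c u))) ⟩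
    2 * (length ss + 2) + 1
      ≡⟨ reorder (length ss) ⟩
    5 + 2 * length ss ∎
    where
    open ≤-Reasoning
    W = δ-walk u x
    reorder : ∀ k → 2 * (k + 2) + 1 ≡ 5 + 2 * k
    reorder = solve-∀
    -- A shortest walk has no repeated vertices, so it meets each element of `ss` at most once.
    count-s : count s W ≤ length ss
    count-s = ≤-trans (≤-reflexive (count≡length s W))
      (unique-length-≤ (Unique.filter⁺ (T? ∘ s) (shortest-unique W refl))
        (λ v∈ → complete (proj₂ (∈-filter⁻ (T? ∘ s) {xs = vertices G W} v∈))))

implies⁻ : ∀ {a b} → T (if a then b else true) → T a → T b
implies⁻ {true} tb _ = tb

implies⁺ : ∀ {a b} → (T a → T b) → T (if a then b else true)
implies⁺ {true}  f = f tt
implies⁺ {false} f = tt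

unless⁻ : ∀ {a b} → T (if a then true else b) → ¬ T a → T b
unless⁻ {true}  _  ¬a = contradiction tt ¬a
unless⁻ {false} tb _  = tb

unless⁺ : ∀ {a b} → (¬ T a → T b) → T (if a then true else b)
unless⁺ {true}  f = tt
unless⁺ {false} f = f id

minimizer : ∀ {A : Set} (f : A → ℕ) {x xs} → x ∈ xs →
            ∃[ y ] y ∈ xs × (∀ {z} → z ∈ xs → f y ≤ f z)
minimizer f {xs = x ∷ []} _ = x , here refl , λ { (here refl) → ≤-refl }
minimizer f {xs = x ∷ xs@(_ ∷ _)} _ with minimizer f {xs = xs} (here refl)
... | y , y∈ , min with ≤-total (f x) (f y)
... | inj₁ fx≤fy = x , here refl , λ
  { (here refl) → ≤-refl ; (there z∈) → ≤-trans fx≤fy (min z∈) }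
... | inj₂ fy≤fx = y , there y∈ , λ
  { (here refl) → fy≤fx ; (there z∈) → min z∈ }

-- Correctness of the guesses

module Verification {n : ℕ} (G : Graph (Fin n)) (S : Subset n)
  (dist-distance : ∀ u v → Distance G u v (Algorithm.dist G S u v)) (L : ℕ)
  where

  open Algorithm G S
  open Walks G
  open Metric G dist dist-distance

  eccentricity-from : ∀ P → (∀ v → ∃[ p ] p ∈ V⟨_⟩ G P × dist v p ≤ L) →
                      HasEccentricity≤ G P (ℤ.+ L)
  eccentricity-from P near v =
    let p , p∈ , dist≤L = near v
        q , q∈ , min = minimizer (dist v) p∈ in
    dist v q , ((q , q∈ , dist-distance v q) ,
                λ { m (w , w∈ , d) →
                  ≤-trans (min w∈) (≤-reflexive (sym (Distance-unique d))) }) ,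
    ℤ.+≤+ (≤-trans (min p∈) dist≤L)

  -- The guard verifies what the guess claims: the vertex `p` at position `g` satisfies
  -- `dist s p ≤ f`, and the triangle inequality through `s` handles a covered vertex. An uncovered
  -- one is forced to be the walk's vertex at its own distance from `x`.
  accept-sound : ∀ A x u → T (acceptᵇ L A x u) →
                 Σ[ P ∈ ShortestPath G ] HasEccentricity≤ G P (ℤ.+ L)
  accept-sound A x u accepted = P , eccentricity-from P near
    where
    t = ∧⁻ {walkᵇ (guardᵇ L A x) (dist u x) x u} accepted
    t′ = ∧⁻ {all (λ (_ , _ , g) → g ≤?ᵇ dist u x) A} (proj₂ t)
    W = proj₁ (walkᵇ-sound S (guardᵇ L A x) (dist u x) (proj₁ t))
    guarded : ∀ {v i} → At W v i → T (guardᵇ L A x i v)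
    guarded = proj₂ (walkᵇ-sound S (guardᵇ L A x) (dist u x) (proj₁ t))
    P : ShortestPath G
    P = record
      { walk       = W
      ; isPath     = shortest-unique W refl
      ; isShortest = dist-distance u x
      }
    near : ∀ v → ∃[ p ] p ∈ vertices G W × dist v p ≤ L
    near v with T? (coveredᵇ L A v)
    ... | yes covered =
      let (s , f , g) , a∈ , ≤L = any-∃ (λ (u , f , g) → (f + dist v u) ≤?ᵇ L) A covered
          g≤ = ≤?ᵇ⇒≤ g (dist u x) (All.lookup (all⁺ _ A (proj₁ t′)) a∈)
          p , at = At-total W g≤
          f≥ = implies⁻ {g =?ᵇ g}
                 (All.lookup (all⁺ _ A (proj₁ (∧⁻ (guarded at)))) a∈)
                 (≡⇒=?ᵇ {g} refl)
      in p , At⇒∈ at , (begin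
        dist v p            ≤⟨ δ-triangle v s p ⟩
        dist v s + dist s p ≤⟨ +-monoʳ-≤ (dist v s) (≤?ᵇ⇒≤ (dist s p) f f≥) ⟩
        dist v s + f        ≡⟨ +-comm (dist v s) f ⟩
        f + dist v s        ≤⟨ ≤?ᵇ⇒≤ (f + dist v s) L ≤L ⟩
        L                   ∎)
      where open ≤-Reasoning
    ... | no uncovered =
      let i≤ = ≤?ᵇ⇒≤ (dist v x) (dist u x)
                 (unless⁻ (All.lookup (all⁺ _ (allFin n) (proj₂ t′)) (∈-allFin v))
                   uncovered)
          p , at = At-total W i≤
          v=p = implies⁻ {dist v x =?ᵇ dist v x}
                  (unless⁻ (All.lookup (all⁺ _ (allFin n)
                    (proj₂ (∧⁻ {all _ A} (guarded at)))) (∈-allFin v)) uncovered)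
                  (≡⇒=?ᵇ {dist v x} refl)
          v≡p = toℕ-injective (=?ᵇ⇒≡ (toℕ v) (toℕ p) v=p)
      in p , At⇒∈ at ,
         ≤-trans (≤-reflexive (trans (cong (dist v) (sym v≡p)) (δ-refl v))) z≤n

  module Completeness
    (c : Fin n → Bool)
    (clique : ∀ {u v} → T (c u) → T (c v) → u ≢ v → Graph._~_ G u v)
    (independent : ∀ {u v} → ¬ T (lookup S u) → ¬ T (c u) →
                   ¬ T (lookup S v) → ¬ T (c v) → ¬ Graph._~_ G u v)
    (dist<D : ∀ u v → dist u v < D)
    (P : ShortestPath G) (ecc : HasEccentricity≤ G P (ℤ.+ L))
    where

    open Graph G using (_~_)
    open ShortestPath P renaming (source to u; target to x; walk to W)

    dist≡len : dist u x ≡ len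
    dist≡len = sym (Distance-unique isShortest)

    At-dist : ∀ {v i} → At W v i → i ≡ dist v x
    At-dist = At-δ W dist≡len

    ∈⇒At-dist : ∀ {v} → v ∈ vertices G W → At W v (dist v x)
    ∈⇒At-dist v∈ = let i , a = ∈⇒At W v∈ in subst (At W _) (At-dist a) a

    nearest : Fin n → Fin n
    nearest v = proj₁ (proj₁ (proj₁ (proj₂ (ecc v))))

    nearest-∈ : ∀ v → nearest v ∈ vertices G W
    nearest-∈ v = proj₁ (proj₂ (proj₁ (proj₁ (proj₂ (ecc v)))))

    nearest-dist : ∀ v → proj₁ (ecc v) ≡ dist v (nearest v)
    nearest-dist v = Distance-unique (proj₂ (proj₂ (proj₁ (proj₁ (proj₂ (ecc v))))))

    nearest-min : ∀ v {w} → w ∈ vertices G W → dist v (nearest v) ≤ dist v w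
    nearest-min v {w} w∈ = ≤-trans (≤-reflexive (sym (nearest-dist v)))
      (proj₂ (proj₁ (proj₂ (ecc v))) _ (w , w∈ , dist-distance v w))

    nearest-≤L : ∀ v → dist v (nearest v) ≤ L
    nearest-≤L v = ≤-trans (≤-reflexive (sym (nearest-dist v)))
      (ℤ.drop‿+≤+ (proj₂ (proj₂ (ecc v))))

    -- The vertices of the closed neighbourhood of the clique are pairwise at
    -- distance at most 3, hence four consecutive vertices of a shortest path
    -- contain all those on it.
    Entry : Fin n → Set
    Entry w = T (c w) ⊎ ∃[ y ] T (c y) × w ~ y

    Entry? : ∀ w → Dec (Entry w)
    Entry? w = T? (c w) ⊎-dec Fin.any? (λ y → T? (c y) ×-dec T? (Graph.adj G w y))

    ~-sym : ∀ {v w} → v ~ w → w ~ v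
    ~-sym {v} {w} = subst T (Graph.sym G v w)

    gate : ∀ {w} → Entry w → ∃[ y ] T (c y) × dist w y ≤ 1 × dist y w ≤ 1
    gate {w} (inj₁ cw)           = w , cw , δ≤1 (clique cw cw) , δ≤1 (clique cw cw)
    gate {w} (inj₂ (y , cy , e)) = y , cy , δ≤ (e ∷ [ y ]) , δ≤ (~-sym e ∷ [ w ])

    Entry-dist≤3 : ∀ {v w} → Entry v → Entry w → dist v w ≤ 3
    Entry-dist≤3 {v} {w} ev ew =
      let y , cy , v-y , _ = gate ev
          z , cz , _ , z-w = gate ew
      in ≤-trans (δ-triangle v y w) (+-mono-≤ v-y
           (≤-trans (δ-triangle y z w) (+-mono-≤ (δ≤1 (clique cy cz)) z-w)))

    last-entry : ∀ {u m} (W : Walk G u x m) →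
                 (∀ {w i} → At W w i → ¬ Entry w) ⊎
                 ∃₂ λ v j → At W v j × Entry v × (∀ {w i} → At W w i → Entry w → j ≤ i)
    last-entry [ u ] with Entry? u
    ... | yes e = inj₂ (u , 0 , head , e , λ _ _ → z≤n)
    ... | no ¬e = inj₁ λ { head → ¬e }
    last-entry (_∷_ {u = u} e W) with last-entry W
    ... | inj₂ (v , j , a , ev , min) =
      inj₂ (v , j , tail a , ev , λ
        { head ew → m≤n⇒m≤1+n (At-≤ a) ; (tail b) ew → min b ew })
    ... | inj₁ none with Entry? u
    ... | yes eu = inj₂ (u , _ , head , eu , λ
        { head _ → ≤-refl ; (tail b) ew → contradiction ew (none b) })
    ... | no ¬eu = inj₁ λ { head → ¬eu ; (tail b) → none b }

    -- Here `j` is the position of the entry nearest to the end; every other entry on the path is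
    -- within distance 3 of that one.
    window : ∃[ j ] (∀ {w} → w ∈ vertices G W → Entry w →
                     j ≤ dist w x × dist w x ≤ 3 + j)
    window with last-entry W
    -- A dummy value, as there is no entry to be located.
    ... | inj₁ none = 0 , λ w∈ ew → contradiction ew (none (∈⇒At-dist w∈))
    ... | inj₂ (v , j , a , ev , min) = j , λ {w} w∈ ew →
      min (∈⇒At-dist w∈) ew ,
      ≤-trans (δ-triangle w v x)
        (+-mono-≤ (Entry-dist≤3 ew ev) (≤-reflexive (sym (At-dist a))))

    -- Truncation at `len` keeps all four positions on the path when the window would extend beyond
    -- its start; repeated triples do no harm.
    quad : ℕ → Triple n
    quad t = let i = (proj₁ window + t) ⊓ len in
      proj₁ (At-total W (m⊓n≤n (proj₁ window + t) len)) , 0 , i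

    assigned : Fin n → Triple n
    assigned v = v , dist v (nearest v) , dist (nearest v) x

    quads : List (Triple n)
    quads = applyUpTo quad 4

    guess : List (Fin n) → List (Triple n)
    guess []       = quads
    guess (s ∷ ss) = assigned s ∷ guess ss

    ∈-triples : ∀ us {v f g} → v ∈ us → f < D → g < D → (v , f , g) ∈ triples us
    ∈-triples us v∈ f<D g<D = ∈-cartesianProductWith⁺ _,_ v∈
      (∈-cartesianProductWith⁺ _,_ (∈-downFrom⁺ f<D) (∈-downFrom⁺ g<D))

    quad-∈ : ∀ t → quad t ∈ triples (allFin n)
    quad-∈ t = ∈-triples (allFin n) (∈-allFin _)
      (≤-trans (s≤s z≤n) (dist<D u u))
      (≤-<-trans (m⊓n≤n (proj₁ window + t) len)
        (≤-<-trans (≤-reflexive (sym dist≡len)) (dist<D u x)))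

    ∈-tuples : ∀ {A} → All (_∈ triples (allFin n)) A → A ∈ tuples (length A)
    ∈-tuples []         = here refl
    ∈-tuples (a∈ ∷ as∈) = ∈-cartesianProductWith⁺ _∷_ a∈ (∈-tuples as∈)

    guess-∈ : ∀ ss → guess ss ∈ guesses ss
    guess-∈ []       = ∈-tuples (quad-∈ 0 ∷ quad-∈ 1 ∷ quad-∈ 2 ∷ quad-∈ 3 ∷ [])
    guess-∈ (s ∷ ss) = ∈-cartesianProductWith⁺ _∷_
      (∈-triples (s ∷ []) (here refl) (dist<D s (nearest s)) (dist<D (nearest s) x))
      (guess-∈ ss)

    Correct : Triple n → Set
    Correct (v , f , g) = ∃[ p ] At W p g × dist v p ≤ f

    guess-correct : ∀ ss → All Correct (guess ss)
    guess-correct [] = All.applyUpTo⁺₂ quad 4 λ t →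
      let p , a = At-total W (m⊓n≤n (proj₁ window + t) len)
      in p , a , ≤-reflexive (δ-refl p)
    guess-correct (s ∷ ss) =
      (nearest s , ∈⇒At-dist (nearest-∈ s) , ≤-refl) ∷ guess-correct ss

    assigned-∈ : ∀ {ss s} → s ∈ ss → assigned s ∈ guess ss
    assigned-∈ (here refl) = here refl
    assigned-∈ (there s∈)  = there (assigned-∈ s∈)

    quads-⊆ : ∀ ss {a} → a ∈ quads → a ∈ guess ss
    quads-⊆ []       a∈ = a∈
    quads-⊆ (s ∷ ss) a∈ = there (quads-⊆ ss a∈)

    entry-∈ : ∀ {w} → w ∈ vertices G W → Entry w → (w , 0 , dist w x) ∈ quads
    entry-∈ {w} w∈ ew =
      subst (_∈ quads) (cong₂ (λ v i → v , 0 , i) same i≡) (∈-applyUpTo⁺ quad (s≤s t≤3))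
      where
      j = proj₁ window
      j≤ = proj₁ (proj₂ window w∈ ew)
      t = dist w x ∸ j
      t≤3 : t ≤ 3
      t≤3 = ≤-trans (∸-monoˡ-≤ j (proj₂ (proj₂ window w∈ ew)))
                    (≤-reflexive (m+n∸n≡m 3 j))
      -- `w` lies on the path, so the truncation has no effect at its position.
      i≡ : (j + t) ⊓ len ≡ dist w x
      i≡ = trans (cong (_⊓ len) (m+[n∸m]≡n j≤)) (m≤n⇒m⊓n≡m (At-≤ (∈⇒At-dist w∈)))
      same : proj₁ (At-total W (m⊓n≤n (j + t) len)) ≡ w
      same = At-functional
        (subst (At W _) i≡ (proj₂ (At-total W (m⊓n≤n (j + t) len)))) (∈⇒At-dist w∈)

    At-end : ∀ {v w m} (R : Walk G v w m) → At R w 0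
    At-end [ _ ]   = head
    At-end (_ ∷ R) = tail (At-end R)

    -- On a nontrivial walk that avoids `S`, the edge into `w` has an end in the clique, by
    -- independence of the rest. Either `w` is that end or it is adjacent to it.
    analyse : ∀ {v w m} (R : Walk G v w m) →
              (∃₂ λ y i → At R y i × T (lookup S y)) ⊎ v ≡ w ⊎ Entry w
    analyse [ v ] = inj₂ (inj₁ refl)
    analyse (_∷_ {u = v} e R) with T? (lookup S v)
    ... | yes sv = inj₁ (v , _ , head , sv)
    ... | no ¬sv with analyse R
    ... | inj₁ (y , i , a , sy)   = inj₁ (y , i , tail a , sy)
    ... | inj₂ (inj₂ entry)       = inj₂ (inj₂ entry)
    ... | inj₂ (inj₁ refl) with T? (lookup S _)
    ... | yes sw = inj₁ (_ , 0 , tail (At-end R) , sw)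
    ... | no ¬sw with T? (c _) | T? (c v)
    ... | yes cw | _      = inj₂ (inj₂ (inj₁ cw))
    ... | no _   | yes cv = inj₂ (inj₂ (inj₂ (v , cv , ~-sym e)))
    ... | no ¬cw | no ¬cv = contradiction e (independent ¬sv ¬cv ¬sw ¬cw)

    M : List (Triple n)
    M = guess modulator

    coveredᵇ⁺ : ∀ {v s f g} → (s , f , g) ∈ M → f + dist v s ≤ L → T (coveredᵇ L M v)
    coveredᵇ⁺ {v} a∈ ≤L =
      any⁺ (λ (s , f , g) → (f + dist v s) ≤?ᵇ L) (lose a∈ (≤⇒≤?ᵇ ≤L))

    -- If a shortest walk from `v` to its nearest path vertex passes through `y ∈ S`, its part after
    -- `y` is at least as long as the distance from `y` to the path, so the triple of `y` already
    -- covers `v`. If it ends in an entry, the triple of that entry does.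
    cover : ∀ v → ¬ T (coveredᵇ L M v) → v ∈ vertices G W
    cover v uncovered with analyse (δ-walk v (nearest v))
    ... | inj₂ (inj₁ v≡) = subst (_∈ vertices G W) (sym v≡) (nearest-∈ v)
    ... | inj₂ (inj₂ entry) = contradiction
      (coveredᵇ⁺ {v} (quads-⊆ modulator (entry-∈ (nearest-∈ v) entry)) (nearest-≤L v))
      uncovered
    ... | inj₁ (y , i , a , sy) =
      let j , R , j+i≡ = prefix a in contradiction
      (coveredᵇ⁺ {v} (assigned-∈ (∈-filter⁺ (T? ∘ lookup S) (∈-allFin y) sy)) (begin
        dist y (nearest y) + dist v y ≤⟨ +-mono-≤ (nearest-min y (nearest-∈ v)) (δ≤ R) ⟩
        dist y (nearest v) + j        ≤⟨ +-monoˡ-≤ j (δ≤ (suffix a)) ⟩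
        i + j                         ≡⟨ +-comm i j ⟩
        j + i                         ≡⟨ j+i≡ ⟩
        dist v (nearest v)            ≤⟨ nearest-≤L v ⟩
        L                             ∎))
      uncovered
      where open ≤-Reasoning

    -- A position on the walk holds only one vertex, so true claims about a position are claims
    -- about `v`.
    guarded : ∀ {v i} → At W v i → T (guardᵇ L M x i v)
    guarded {v} {i} a = ∧⁺
      ( all⁻ _ (All.map (λ {b} → obeys {b}) (guess-correct modulator))
      , all⁻ _ (All.tabulate {xs = allFin n} λ {w} _ →
          unless⁺ {coveredᵇ L M w} λ uncovered →
          implies⁺ {dist w x =?ᵇ i} λ ≡i → ≡⇒=?ᵇ (cong toℕ
            (At-functional
              (subst (At W w) (=?ᵇ⇒≡ (dist w x) i ≡i)
                (∈⇒At-dist (cover w uncovered)))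
              a))))
      where
      obeys : ∀ {b} → Correct b →
              T (let s , f , g = b in if g =?ᵇ i then dist s v ≤?ᵇ f else true)
      obeys {s , f , g} (p , a′ , ≤f) = implies⁺ {g =?ᵇ i} λ g=i →
        ≤⇒≤?ᵇ (subst (λ p → dist s p ≤ f)
          (At-functional (subst (At W p) (=?ᵇ⇒≡ g i g=i) a′) a) ≤f)

    accepted : T (acceptᵇ L M x u)
    accepted = ∧⁺
      ( subst (λ m → T (walkᵇ (guardᵇ L M x) m x u)) (sym dist≡len)
          (walkᵇ-complete S (guardᵇ L M x) W guarded)
      , ∧⁺
        ( all⁻ _ (All.map (λ (p , a , _) → ≤⇒≤?ᵇ (At≤ a)) (guess-correct modulator))
        , all⁻ _ (All.tabulate {xs = allFin n} λ {w} _ →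
            unless⁺ {coveredᵇ L M w} λ uncovered →
            ≤⇒≤?ᵇ (At≤ (∈⇒At-dist (cover w uncovered))))))
      where
      At≤ : ∀ {v i} → At W v i → i ≤ dist u x
      At≤ a = ≤-trans (At-≤ a) (≤-reflexive (sym dist≡len))

    answered : T (answer L)
    answered = any⁺ _ (lose (guess-∈ modulator)
      (any⁺ _ (lose (∈-allFin x) (any⁺ _ (lose (∈-allFin u) accepted)))))

-- Running time

n≤2^⌈log₂n⌉ : ∀ n → n ≤ 2 ^ ⌈log₂ n ⌉
n≤2^⌈log₂n⌉ = <-rec (λ n → n ≤ 2 ^ ⌈log₂ n ⌉) λ
  { 0 _ → z≤n
  ; 1 _ → ≤-refl
  ; n@(suc (suc m)) ih → begin
      n                              ≡⟨ ⌊n/2⌋+⌈n/2⌉≡n n ⟨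
      ⌊ n /2⌋ + ⌈ n /2⌉              ≤⟨ +-monoˡ-≤ ⌈ n /2⌉ (⌊n/2⌋≤⌈n/2⌉ n) ⟩
      ⌈ n /2⌉ + ⌈ n /2⌉              ≡⟨ cong (⌈ n /2⌉ +_) (+-identityʳ _) ⟨
      2 * ⌈ n /2⌉                    ≤⟨ *-monoʳ-≤ 2 (ih (⌈n/2⌉<n m)) ⟩
      2 ^ suc ⌈log₂ ⌈ n /2⌉ ⌉        ≡⟨ cong (λ k → 2 ^ suc k) (⌈log₂⌈n/2⌉⌉≡⌈log₂n⌉∸1 n) ⟩
      2 ^ suc (⌈log₂ n ⌉ ∸ 1)        ≡⟨ cong (2 ^_) (m+[n∸m]≡n {1} (log≥1 m)) ⟩
      2 ^ ⌈log₂ n ⌉                  ∎ }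
  where
  open ≤-Reasoning
  log≥1 : ∀ m → 1 ≤ ⌈log₂ suc (suc m) ⌉
  log≥1 m = ≤-trans (≤-reflexive (sym (⌈log₂2^n⌉≡n 1)))
                    (⌈log₂⌉-mono-≤ {2} {suc (suc m)} (s≤s (s≤s z≤n)))

-- For `k ≥ 2` the base is at most `k ^ 4` and the exponent at most `6 * k`, whence `24 = 4 * 6`. At
-- `k = 2` neither 4 nor 6 can be lowered: the base is 9 and the exponent 12.
guesses-bound-≥2 : ∀ m → let k = 2 + m in
                   (5 + 2 * k) ^ (2 * (k + 4)) ≤ 2 ^ (24 * (k * ⌈log₂ k ⌉))
guesses-bound-≥2 m = begin
  (5 + 2 * k) ^ (2 * (k + 4))              ≤⟨ ^-monoʳ-≤ (5 + 2 * k) exponent ⟩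
  (5 + 2 * k) ^ (6 * k)                    ≤⟨ ^-monoˡ-≤ (6 * k) base ⟩
  (k ^ 4) ^ (6 * k)
    ≤⟨ ^-monoˡ-≤ (6 * k) (^-monoˡ-≤ 4 (n≤2^⌈log₂n⌉ k)) ⟩
  ((2 ^ l) ^ 4) ^ (6 * k)                  ≡⟨ cong (_^ (6 * k)) (^-*-assoc 2 l 4) ⟩
  (2 ^ (l * 4)) ^ (6 * k)                  ≡⟨ ^-*-assoc 2 (l * 4) (6 * k) ⟩
  2 ^ (l * 4 * (6 * k))                    ≡⟨ cong (2 ^_) (reorder l k) ⟩
  2 ^ (24 * (k * l))                       ∎
  where
  open ≤-Reasoning
  k = 2 + m
  l = ⌈log₂ k ⌉
  exponent : 2 * (k + 4) ≤ 6 * k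
  exponent = ≤-trans (m≤m+n _ (4 * m)) (≤-reflexive (eq m))
    where
    eq : ∀ m → 2 * (2 + m + 4) + 4 * m ≡ 6 * (2 + m)
    eq = solve-∀
  base : 5 + 2 * k ≤ k ^ 4
  base = ≤-trans (m≤m+n _ _) (≤-reflexive (eq m))
    where
    -- The added polynomial is the difference of the two sides, expanded in `m = k - 2`; all its
    -- coefficients are nonnegative.
    eq : ∀ m → 5 + 2 * (2 + m) +
               (7 + 30 * m + 24 * (m * m) + 8 * (m * m * m) + m * m * m * m)
             ≡ (2 + m) * ((2 + m) * ((2 + m) * ((2 + m) * 1)))
    eq = solve-∀
  reorder : ∀ l k → l * 4 * (6 * k) ≡ 24 * (k * l)
  reorder = solve-∀

-- The factor B takes care of k ≤ 1, where k log k vanishes.  It is opaque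
-- because Agda would unfold multiplications by such a large numeral.
opaque
  B : ℕ
  B = 7 ^ 10

  5^8≤B : 5 ^ 8 ≤ B
  5^8≤B = ≤ᵇ⇒≤ (5 ^ 8) (7 ^ 10) _

  7^10≤B : 7 ^ 10 ≤ B
  7^10≤B = ≤-refl

-- The left side is `5 ^ 8` at `k = 0` and `7 ^ 10` at `k = 1`, which is how `B` arises.
guesses-bound : ∀ k → (5 + 2 * k) ^ (2 * (k + 4)) ≤ B * 2 ^ (24 * (k * ⌈log₂ k ⌉))
guesses-bound 0             = ≤-trans 5^8≤B (≤-reflexive (sym (*-identityʳ B)))
guesses-bound 1             = ≤-trans 7^10≤B (≤-reflexive (sym (*-identityʳ B)))
guesses-bound (suc (suc m)) = ≤-trans (guesses-bound-≥2 m)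
  (m≤n*m _ B {{>-nonZero (≤-trans (s≤s z≤n) 5^8≤B)}})

^-distribʳ-* : ∀ k m n → (m * n) ^ k ≡ m ^ k * n ^ k
^-distribʳ-* zero    m n = refl
^-distribʳ-* (suc k) m n = trans (cong (m * n *_) (^-distribʳ-* k m n))
  (interchange m n (m ^ k) (n ^ k))
  where
  interchange : ∀ a b x y → a * b * (x * y) ≡ a * x * (b * y)
  interchange = solve-∀

length-filterᵇ-map : ∀ {A B : Set} (f : A → B) (p : B → Bool) xs →
  length (filterᵇ p (List.map f xs)) ≡ length (filterᵇ (p ∘ f) xs)
length-filterᵇ-map f p []       = refl
length-filterᵇ-map f p (x ∷ xs) with p (f x)
... | true  = cong suc (length-filterᵇ-map f p xs)
... | false = length-filterᵇ-map f p xs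

length-filter-allFin : ∀ {n} (S : Subset n) →
                       length (filterᵇ (lookup S) (allFin n)) ≡ ∣ S ∣
length-filter-allFin [] = refl
length-filter-allFin (b ∷ S) = cons b (trans
  (cong (length ∘ filterᵇ (lookup (b ∷ S))) (sym (map-tabulate id suc)))
  (trans (length-filterᵇ-map suc (lookup (b ∷ S)) (allFin _)) (length-filter-allFin S)))
  where
  cons : ∀ {n} {S : Subset n} b {us} → length (filterᵇ (lookup (b ∷ S)) us) ≡ ∣ S ∣ →
         length (filterᵇ (lookup (b ∷ S)) (zero ∷ us)) ≡ ∣ b ∷ S ∣
  cons true  eq = cong suc eq
  cons false eq = eq

power-bound : ∀ {N} c d B a X n e → N ≤ B * 2 ^ (a * X) * n ^ e →
              c * N ^ d ≤ c * B ^ d * 2 ^ (a * d * X) * n ^ (e * d)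
power-bound {N} c d B a X n e N≤ = begin
  c * N ^ d                                       ≤⟨ *-monoʳ-≤ c (^-monoˡ-≤ d N≤) ⟩
  c * (B * 2 ^ (a * X) * n ^ e) ^ d
    ≡⟨ cong (c *_) (trans (^-distribʳ-* d (B * 2 ^ (a * X)) (n ^ e))
         (cong₂ _*_ (^-distribʳ-* d B (2 ^ (a * X))) (^-*-assoc n e d))) ⟩
  c * (B ^ d * (2 ^ (a * X)) ^ d * n ^ (e * d))
    ≡⟨ cong (λ y → c * (B ^ d * y * n ^ (e * d)))
         (trans (^-*-assoc 2 (a * X) d) (cong (2 ^_) (reorder a X d))) ⟩
  c * (B ^ d * 2 ^ (a * d * X) * n ^ (e * d))
    ≡⟨ assoc c (B ^ d) (2 ^ (a * d * X)) (n ^ (e * d)) ⟩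
  c * B ^ d * 2 ^ (a * d * X) * n ^ (e * d)       ∎
  where
  open ≤-Reasoning
  reorder : ∀ a x d → a * x * d ≡ a * d * x
  reorder = solve-∀
  assoc : ∀ w x y z → w * (x * y * z) ≡ w * x * y * z
  assoc = solve-∀

-- Correctness and running time on a given instance

opaque
  -- Opacity keeps the coefficient and the degree symbolic.
  algorithm-poly : Polynomial (λ N → 8 + steps algorithm N)
  algorithm-poly = constant-poly 8 +-poly steps-poly algorithm

module Instance {n : ℕ} (G : Graph (Fin n)) (S : Subset n)
  (connected : Connected G) (split : IsSplit (G ─ S)) where

  open Graph G using (_~_)
  open Algorithm G S
  open Sizes G S
  open Walks G

  walkable : Fin n → Fin n → ℕ → Bool
  walkable u x i = walkᵇ (λ _ _ → true) i x u

  Walk⇒walkable : ∀ {u x i} → Walk G u x i → T (walkable u x i)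
  Walk⇒walkable W = walkᵇ-complete S _ W _

  minimum⇒Distance : ∀ {u x d} → IsMinimum (T ∘ walkable u x) d → Distance G u x d
  minimum⇒Distance {u} {x} (t , min) =
    proj₁ (walkᵇ-sound S _ _ t) , λ m W → min m (Walk⇒walkable W)

  -- The search limit is the length of a walk supplied by connectedness, so `δ` is the distance
  -- before any bound is known. The bound by `D` proved for `δ` then shows that the search limit of
  -- `dist` suffices.
  δ : Fin n → Fin n → ℕ
  δ u x = least (walkable u x) (proj₁ (proj₂ connected u x))

  δ-distance : ∀ u x → Distance G u x (δ u x)
  δ-distance u x = let m , W = proj₂ connected u x in
    minimum⇒Distance (least-minimum (walkable u x) {m} m (Walk⇒walkable W) ≤-refl)

  ∉-S : ∀ {v} → ¬ T (lookup S v) → v Subset.∉ S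
  ∉-S {v} ¬s v∈ = ¬s (subst T (sym ([]=⇒lookup v∈)) _)

  -- The clique is given only on vertices with a proof of lying outside `S`; it is extended by
  -- `false`.
  c : Fin n → Bool
  c v with T? (lookup S v)
  ... | yes _ = false
  ... | no ¬s = proj₁ split (v , [ ∉-S ¬s ])

  clique : ∀ {u v} → T (c u) → T (c v) → u ≢ v → u ~ v
  clique {u} {v} cu cv u≢v with T? (lookup S u) | T? (lookup S v)
  ... | no _ | no _ = proj₁ (proj₂ split) cu cv (u≢v ∘ cong value)

  independent : ∀ {u v} → ¬ T (lookup S u) → ¬ T (c u) →
                ¬ T (lookup S v) → ¬ T (c v) → ¬ (u ~ v)
  independent {u} {v} ¬su ¬cu ¬sv ¬cv with T? (lookup S u) | T? (lookup S v)
  ... | yes su | _      = contradiction su ¬su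
  ... | no _   | yes sv = contradiction sv ¬sv
  ... | no _   | no _   = proj₂ (proj₂ split) (T-not ¬cu) (T-not ¬cv)
    where
    T-not : ∀ {b} → ¬ T b → T (not b)
    T-not {true}  ¬b = contradiction _ ¬b
    T-not {false} _  = _

  δ<D : ∀ u x → δ u x < D
  δ<D u x = ≤-trans
    (Diameter.δ-bound G δ δ-distance (lookup S) c clique independent
      (λ {v} s → ∈-filter⁺ (T? ∘ lookup S) (∈-allFin v) s) u x)
    (≤-reflexive (sym (width≡ modulator)))

  dist-distance : ∀ u x → Distance G u x (dist u x)
  dist-distance u x = minimum⇒Distance
    (least-minimum (walkable u x) D (Walk⇒walkable (proj₁ (δ-distance u x)))
      (<⇒≤ (δ<D u x)))

  dist<D : ∀ u x → dist u x < D
  dist<D u x = ≤-<-trans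
    (≤-reflexive (Metric.Distance-unique G δ δ-distance (dist-distance u x))) (δ<D u x)

  instance
    n≢0 : NonZero n
    n≢0 = nonZeroIndex (proj₁ connected)

    N≢0 : NonZero N
    N≢0 = >-nonZero (≤-trans (>-nonZero⁻¹ n) n≤N)

  decide-correct : ∀ ℓ → Reflects (Σ[ P ∈ ShortestPath G ] HasEccentricity≤ G P ℓ)
                                  (decideᵇ ℓ)
  decide-correct (ℤ.+ L) = fromEquivalence
    (λ t → let A , _ , t = any-∃ _ (guesses modulator) t
               x , _ , t = any-∃ _ (allFin n) t
               u , _ , t = any-∃ _ (allFin n) t
           in accept-sound A x u t)
    (λ (P , ecc) → Completeness.answered c clique independent dist<D P ecc)
    where open Verification G S dist-distance L
  decide-correct ℤ.-[1+ _ ] = fromEquivalence (λ ())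
    (λ (P , ecc) → case-negative (proj₂ (proj₂ (ecc (proj₁ connected)))))
    where
    case-negative : ∀ {d m} → ℤ.+ d ℤ.≤ ℤ.-[1+ m ] → T false
    case-negative ()

  N≤ : ∀ {k} → ∣ S ∣ ≡ k → N ≤ B * 2 ^ (24 * (k * ⌈log₂ k ⌉)) * n ^ 4
  N≤ refl = begin
    N ≡⟨ length-guesses modulator ⟩
    (D * D) ^ length modulator * (n * (D * D)) ^ 4
      ≡⟨ cong₂ _*_ (cong ((D * D) ^_) (length-filter-allFin S)) (^-distribʳ-* 4 n (D * D)) ⟩
    (D * D) ^ k * (n ^ 4 * (D * D) ^ 4)
      ≡⟨ reorder ((D * D) ^ k) (n ^ 4) ((D * D) ^ 4) ⟩
    (D * D) ^ k * (D * D) ^ 4 * n ^ 4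
      ≡⟨ cong (_* n ^ 4) (^-distribˡ-+-* (D * D) k 4) ⟨
    (D * D) ^ (k + 4) * n ^ 4
      ≡⟨ cong (λ x → (D * x) ^ (k + 4) * n ^ 4) (*-identityʳ D) ⟨
    (D ^ 2) ^ (k + 4) * n ^ 4
      ≡⟨ cong (_* n ^ 4) (^-*-assoc D 2 (k + 4)) ⟩
    D ^ (2 * (k + 4)) * n ^ 4
      ≡⟨ cong (λ d → d ^ (2 * (k + 4)) * n ^ 4)
           (trans (width≡ modulator) (cong (λ k → 5 + 2 * k) (length-filter-allFin S))) ⟩
    (5 + 2 * k) ^ (2 * (k + 4)) * n ^ 4
      ≤⟨ *-monoˡ-≤ (n ^ 4) (guesses-bound k) ⟩
    B * 2 ^ (24 * (k * ⌈log₂ k ⌉)) * n ^ 4 ∎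
    where
    open ≤-Reasoning
    k = ∣ S ∣
    reorder : ∀ a b c → a * (b * c) ≡ a * c * b
    reorder = solve-∀

  solve : ∀ {k} ℓ → ∣ S ∣ ≡ k →
          ∃[ b ] ∃[ t ]
            compile algorithm ⟪ ⌜ G ⌝ᴳ ∷ ⌜ S ⌝ˢ ∷ ⌜ ℓ ⌝ℤ ∷ [] ⟫⇓ ⌜ b ⌝ᵇ [ t ]
            × Reflects (Σ[ P ∈ ShortestPath G ] HasEccentricity≤ G P ℓ) b
            × t ≤ proj₁ algorithm-poly * B ^ proj₁ (proj₂ algorithm-poly)
                  * 2 ^ (24 * proj₁ (proj₂ algorithm-poly) * (k * ⌈log₂ k ⌉))
                  * n ^ (4 * proj₁ (proj₂ algorithm-poly))
  solve {k} ℓ |S|≡k =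
    let c , d , bound = algorithm-poly
        t , run , t≤ = compile-correct {e = algorithm} (algorithm-↦ ℓ)
    in decideᵇ ℓ , t , run , decide-correct ℓ ,
       ≤-trans t≤ (≤-trans (bound N)
         (power-bound c d B 24 (k * ⌈log₂ k ⌉) n 4 (N≤ |S|≡k)))

theorem4 : Σ[ p ∈ Program 3 ] ∃[ c ] ∃[ a ] ∃[ d ]
    (∀ (n k : ℕ) (G : Graph (Fin n)) (S : Subset n) (ℓ : ℤ) →
    Connected G → ∣ S ∣ ≡ k → IsSplit (G ─ S) →
    ∃[ b ] ∃[ t ]
    p ⟪ ⌜ G ⌝ᴳ ∷ ⌜ S ⌝ˢ ∷ ⌜ ℓ ⌝ℤ ∷ [] ⟫⇓ ⌜ b ⌝ᵇ [ t ]
    × Reflects (Σ[ P ∈ ShortestPath G ] HasEccentricity≤ G P ℓ) b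
    × t ≤ c * 2 ^ (a * (k * ⌈log₂ k ⌉)) * n ^ d)
theorem4 =
  compile algorithm , proj₁ algorithm-poly * B ^ proj₁ (proj₂ algorithm-poly) ,
  24 * proj₁ (proj₂ algorithm-poly) , 4 * proj₁ (proj₂ algorithm-poly) ,
  λ n k G S ℓ connected |S|≡k split →
    Instance.solve G S connected split ℓ |S|≡k
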